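{- Let $G$ be a graph. Then $G$ is a $D(3)$ graph if and only if $G\in\mathcal{D}(3)$, where $\mathcal{D}(3)$ is the class of graphs constructed in the context. In particular, there is no planar $D(3)$ graph.
   Context: All graphs are simple and connected. $\gamma(G)$ denotes the domination number and $\chi(G)$ the chromatic number of $G$. A coloring of $G$ with $k$ colors is a partition $C=(V_1,\dots,V_k)$ of $V(G)$ into independent sets, called color classes. A dominator coloring of $G$ is a coloring in which every vertex either is the only vertex of its own color class or is adjacent to every vertex of some color class; the dominator chromatic number $\chi_d(G)$ is the minimum number of colors in a dominator coloring of $G$. A graph $G$ is called a $D(k)$ graph if $\gamma(G)=\chi(G)=\chi_d(G)=k$. The class $\mathcal{D}(3)$: Let $V_1,V_2,V_3$ be three independent sets with $|V_1|\ge 3$, $|V_2|\ge 3$ and $|V_3|=1$. For $1\le i\le 3$, let $x_i\in V_i$, and let vertices $y_1,y_2,y_3$ be such that $x_i$ is adjacent to $y_j$ if and only if $i=j$. Further, let $y_1,y_3\in V_2$ and $y_2\in V_1$. A graph in the class $\mathcal{D}(3)$ is obtained from $V_1,V_2,V_3$ by adding edges as follows. (a) Join $y_1$ to every vertex in $V_1$ and join $y_2$ to every vertex in $V_2$. (b) Join $x_1$ to $x_3$ and join $x_1$ to some (or all) of the vertices of $V_2\setminus\{y_3\}$. (c) Join $y_3$ to some (or all) of the vertices of $V_1\setminus\{x_1\}$. (d) Join each vertex in $V_1\setminus\{x_1,y_2\}$ to every vertex in $V_2$ or $V_3$ (but not both), and join each vertex in $V_2\setminus\{y_3,y_1\}$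 to every vertex in $V_1$ or $V_3$ (but not both), in such a way that $x_3$ has at least two non-neighbors in both $V_1$ and $V_2$. (e) For all $x\in V_1$, $y\in V_2$ such that $xy\notin E(G)$, either $x$ has at least one non-neighbor other than $y$ in $V_2$ or $y$ has at least one non-neighbor other than $x$ in $V_1$.
   Formalization: In the class D(3), rules (a)–(e) are read as constraints: further edges between V1 and V2 that they do not forbid are allowed. If only the listed edges could be added, the equivalence would be false. -}

module Defs where

open import Data.Fin using (Fin; _<?_; _≟_)
open import Data.Fin.Patterns using (0F; 1F; 2F)
open import Data.Fin.Subset using (Subset; ∣_∣; _∈_)
open import Data.List using (length; filter; cartesianProduct; allFin)
open import Data.Nat using (ℕ; _+_; _≤_; _≥_)
open import Data.Nat.GeneralisedArithmetic using (iterate)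
open import Data.Product using (Σ-syntax; ∃₂; ∃-syntax; _×_; _,_)
open import Data.Sum using (_⊎_)
open import Data.Vec as Vec using ()
open import Function.Bundles using (_⇔_)
open import Function.Definitions using (StrictlySurjective)
open import Level using (0ℓ)
open import Relation.Binary.Construct.Closure.ReflexiveTransitive using (Star)
open import Relation.Binary.Core using (Rel)
open import Relation.Binary.Definitions using (Decidable; Irreflexive; Symmetric)
open import Relation.Binary.PropositionalEquality using (_≡_; _≢_)
open import Relation.Nullary using (¬_)
open import Relation.Nullary.Decidable using (_×-dec_)
open import Relation.Unary using (Pred)

-- Finite, simple and connected.
record Graph : Set₁ where
  infix 4 _~_ _~?_
  field
    n         : ℕ
    _~_       : Rel (Fin n) 0ℓ
    _~?_      : Decidable _~_
    ~-sym     : Symmetric _~_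
    ~-irrefl  : Irreflexive _≡_ _~_
    connected : ∀ u v → Star _~_ u v

  Vertex : Set
  Vertex = Fin n

IsLeast : Pred ℕ 0ℓ → ℕ → Set
IsLeast P k = P k × (∀ j → P j → k ≤ j)

OneButNotBoth : Set → Set → Set
OneButNotBoth A B = (A × ¬ B) ⊎ (¬ A × B)

module _ (G : Graph) where
  open Graph G

  CompleteTo : Vertex → Pred Vertex 0ℓ → Set
  CompleteTo v P = ∀ u → P u → v ~ u

  Dominating : Subset n → Set
  Dominating S = ∀ v → v ∈ S ⊎ (∃[ u ] (u ∈ S × u ~ v))

  -- A partition into k independent sets, hence with every class inhabited.
  -- Without `onto`, every vertex would vacuously be complete to an empty class.
  record Coloring (k : ℕ) : Set where
    field
      color  : Vertex → Fin k
      onto   : StrictlySurjective _≡_ color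
      proper : ∀ {u v} → u ~ v → color u ≢ color v

    Class : Fin k → Pred Vertex 0ℓ
    Class i v = color v ≡ i

    classSize : Fin k → ℕ
    classSize i = Vec.count (λ v → color v ≟ i) (Vec.allFin n)

  IsDominator : ∀ {k} → Coloring k → Set
  IsDominator C = ∀ v →
      (∀ u → color u ≡ color v → u ≡ v)
    ⊎ (∃[ i ] CompleteTo v (Class i))
    where open Coloring C

  DominationNumber≡ : ℕ → Set
  DominationNumber≡ = IsLeast λ k → ∃[ S ] (Dominating S × ∣ S ∣ ≡ k)

  ChromaticNumber≡ : ℕ → Set
  ChromaticNumber≡ = IsLeast Coloring

  DominatorChromaticNumber≡ : ℕ → Set
  DominatorChromaticNumber≡ = IsLeast λ k → ∃[ C ] IsDominator {k} C

  IsD : ℕ → Set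
  IsD k = DominationNumber≡ k × ChromaticNumber≡ k × DominatorChromaticNumber≡ k

  -- Graphs built from V₁, V₂, V₃ by adding edges. The build rules are stated
  -- as constraints: an edge between V₁ and V₂ that no field forces or forbids is
  -- free. So b₂ and c, where "some or all" edges are added, ask for one edge,
  -- and a vertex complete to V₃ in d₁ or d₂ may still be adjacent to part, but
  -- not all, of the opposite side.
  record In𝒟₃ : Set where
    field
      parts : Coloring 3

    open Coloring parts public

    V₁ : Pred Vertex 0ℓ
    V₁ = Class 0F
    V₂ : Pred Vertex 0ℓ
    V₂ = Class 1F
    V₃ : Pred Vertex 0ℓ
    V₃ = Class 2F

    field
      ∣V₁∣≥3 : classSize 0F ≥ 3
      ∣V₂∣≥3 : classSize 1F ≥ 3
      ∣V₃∣≡1 : classSize 2F ≡ 1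
      x y    : Fin 3 → Vertex

    x₁ : Vertex
    x₁ = x 0F
    x₂ : Vertex
    x₂ = x 1F
    x₃ : Vertex
    x₃ = x 2F
    y₁ : Vertex
    y₁ = y 0F
    y₂ : Vertex
    y₂ = y 1F
    y₃ : Vertex
    y₃ = y 2F

    field
      x∈V   : ∀ i → Class i (x i)
      x~y   : ∀ i j → x i ~ y j ⇔ i ≡ j
      y₁∈V₂ : V₂ y₁
      y₂∈V₁ : V₁ y₂
      y₃∈V₂ : V₂ y₃

      a₁ : CompleteTo y₁ V₁
      a₂ : CompleteTo y₂ V₂

      b₁ : x₁ ~ x₃
      b₂ : ∃[ w ] (V₂ w × w ≢ y₃ × x₁ ~ w)

      c  : ∃[ v ] (V₁ v × v ≢ x₁ × y₃ ~ v)

      d₁ : ∀ v → V₁ v → v ≢ x₁ → v ≢ y₂ →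
           OneButNotBoth (CompleteTo v V₂) (CompleteTo v V₃)
      d₂ : ∀ w → V₂ w → w ≢ y₃ → w ≢ y₁ →
           OneButNotBoth (CompleteTo w V₁) (CompleteTo w V₃)
      d₃ : ∃₂ λ u v → u ≢ v × V₁ u × V₁ v × ¬ x₃ ~ u × ¬ x₃ ~ v
      d₄ : ∃₂ λ u v → u ≢ v × V₂ u × V₂ v × ¬ x₃ ~ u × ¬ x₃ ~ v

      e  : ∀ v w → V₁ v → V₂ w → ¬ v ~ w →
           (∃[ w′ ] (V₂ w′ × w′ ≢ w × ¬ v ~ w′))
         ⊎ (∃[ v′ ] (V₁ v′ × v′ ≢ v × ¬ w ~ v′))

  edgeCount : ℕ
  edgeCount = length (filter (λ (u , v) → (u <? v) ×-dec (u ~? v))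
                             (cartesianProduct (allFin n) (allFin n)))

  -- An embedding in the sphere, as a rotation system of genus 0: `next v`
  -- permutes the neighbors of v cyclically, the faces are the orbits of `trace`
  -- on the directed edges, and Euler's formula V - E + F = 2 holds.
  record SphericalEmbedding : Set where
    field
      next   : Vertex → Vertex → Vertex
      next-~ : ∀ {u v} → v ~ u → v ~ next v u
      cyclic : ∀ {u v w} → v ~ u → v ~ w → ∃[ k ] iterate (next v) u k ≡ w

    trace : Vertex × Vertex → Vertex × Vertex
    trace (u , v) = v , next v u

    field
      faceCount  : ℕ
      face       : ∀ {u v} → u ~ v → Fin faceCount
      face-onto  : ∀ i → ∃₂ λ u v → Σ[ p ∈ u ~ v ] face p ≡ i
      face-orbit : ∀ {u v u′ v′} (p : u ~ v) (p′ : u′ ~ v′) →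
                   face p ≡ face p′ ⇔ (∃[ k ] iterate trace (u , v) k ≡ (u′ , v′))
      euler      : n + faceCount ≡ edgeCount + 2

  -- A graph without edges is planar, but the single face of its embedding is
  -- not an orbit of directed edges.
  Planar : Set
  Planar = (∀ u v → ¬ u ~ v) ⊎ SphericalEmbedding

{-# OPTIONS --safe #-}

-- γ ≥ 3 says that every pair of vertices leaves a vertex undominated, and each
-- defining property of 𝒟(3) comes from applying this to a suitable pair. If no
-- color class of a dominator coloring were a singleton, two vertices complete to
-- each other's classes would dominate; so one class is {x₃}, a vertex of another
-- class not adjacent to x₃ is complete to the opposite one, and the rest follows.
-- Conversely χ ≥ 3 because of the 5-cycle x₁ x₃ y₃ y₂ y₁.
--
-- Such a graph contains K₃,₃ with one edge subdivided by x₃. Nonplanarity is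
-- proved by F₂-homology: in an embedding with V - E + F = 2 every cycle is the
-- set of edges across which some 2-coloring of the faces changes (a dimension
-- count), so that crossing chords of a cycle lie on different sides of it. The
-- heptagon in the subdivided K₃,₃ has three pairwise crossing chords.

module Submission where

open import Defs
import Algebra.Properties.CommutativeMonoid.Sum
import Algebra.Properties.CommutativeSemigroup
import Data.Bool as Bool
open import Algebra.Bundles using (CommutativeRing)
open import Data.Bool using (Bool; true; false; if_then_else_; _∧_; _xor_; not)
open import Data.Bool.Properties
  using (xor-∧-commutativeRing; xor-comm; xor-assoc; xor-same; xor-identityʳ; ∧-comm; ∧-assoc;
    ∧-zeroʳ; ∧-identityʳ; ∧-distribˡ-xor; ∧-distribʳ-xor)
open import Data.Empty using (⊥; ⊥-elim)
open import Data.Fin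
  using (Fin; zero; combine; suc; _↑ˡ_; _↑ʳ_; splitAt; join; funToFin; finToFun; punchOut; _≟_;
    _<?_; _<_)
open import Data.Fin.Patterns using (0F; 1F; 2F; 3F; 4F; 5F; 6F)
open import Data.Fin.Permutation
  using (Permutation′; permutation; transpose; _⟨$⟩ʳ_; _⟨$⟩ˡ_; inverseˡ; inverseʳ)
open import Data.Fin.Properties
  using (any?; injective⇒≤; punchOut-injective; finToFun-funToFin; funToFin-finToFin; 2↔Bool;
    splitAt-↑ˡ; splitAt-↑ʳ; join-splitAt; <-cmp; all?)
open import Data.Fin.Subset using (Subset; ∣_∣; _∈_; _⊆_; _∪_; ⁅_⁆; inside; outside)
open import Data.Fin.Subset.Properties
  using (x∈⁅x⁆; ∣⁅x⁆∣≡1; x∈p∪q⁺; p⊆q⇒∣p∣≤∣q∣; x∈p∧x≢y⇒x∈p-y; x∈p⇒∣p-x∣<∣p∣; _∈?_; nonempty?)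
open import Data.List using (List; lookup; filter; cartesianProduct; allFin)
open import Data.List.Membership.Propositional.Properties using (∈-filter⁺; ∈-cartesianProduct⁺; ∈-allFin)
open import Data.List.Relation.Unary.Any using (index)
open import Data.List.Relation.Unary.Any.Properties using (lookup-index)
open import Data.Nat using (ℕ; zero; suc; _+_; _^_; _≤_; z≤n; s≤s; s≤s⁻¹; _≤?_)
open import Data.Nat.GeneralisedArithmetic using (iterate)
open import Data.Nat.Properties
  using (1+n≰n; +-comm; ≤-trans; ≤-reflexive; ≤-antisym; ≤-refl; m≤n⇒m≤1+n; +-monoʳ-≤; +-suc; ≰⇒>;
    <⇒≱)
open import Data.Product using (∃-syntax; _×_; _,_; proj₁; proj₂; ∃₂)
open import Data.Sum using (_⊎_; inj₁; inj₂; [_,_]′)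
open import Data.Vec as Vec using (Vec; []; _∷_)
open import Data.Vec.Properties using ([]=⇒lookup; lookup⇒[]=; lookup∘tabulate)
open import Data.Vec.Relation.Unary.All as All using (All; []; _∷_)
open import Data.Vec.Relation.Unary.AllPairs using ([]; _∷_)
open import Data.Vec.Relation.Unary.Unique.Propositional using (Unique)
open import Data.Vec.Relation.Unary.Unique.Propositional.Properties using (lookup-injective)
open import Function using (_∘_; id; Inverse; Equivalence; mk⇔; _⇔_)
open import Function.Definitions using (Injective)
open import Level using (0ℓ)
open import Relation.Binary.Construct.Closure.ReflexiveTransitive using (Star; ε; _◅_; gmap)
open import Relation.Binary.Core using (Rel)
open import Relation.Binary.Definitions using (tri<; tri≈; tri>)
open import Relation.Binary.PropositionalEquality
open import Relation.Nullary using (¬_; yes; no; does; contradiction)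
open import Relation.Nullary.Decidable
  using (dec-true; dec-false; _×-dec_; True; toWitness; _⊎-dec_; _→-dec_; ¬?; decidable-stable;
    from-yes)
open import Relation.Unary using (Pred; Decidable)

open Algebra.Properties.CommutativeSemigroup (CommutativeRing.+-commutativeSemigroup xor-∧-commutativeRing)
  using () renaming (interchange to xor-interchange)
open Algebra.Properties.CommutativeSemigroup (CommutativeRing.*-commutativeSemigroup xor-∧-commutativeRing)
  using () renaming (x∙yz≈y∙xz to x∧yz≡y∧xz)
open Algebra.Properties.CommutativeMonoid.Sum (CommutativeRing.+-commutativeMonoid xor-∧-commutativeRing)
  using (sum; sum-cong-≗; sum-replicate-zero; ∑-distrib-+; ∑-comm; sum-permute)

open ≡-Reasoning

-- Finite injections and surjections

-- Pigeonhole: if `y` were missed, punching it out of the codomain would leave an injection into a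
-- smaller set.
injective⇒strictlySurjective : ∀ {m} (f : Fin m → Fin m) → Injective _≡_ _≡_ f → ∀ y → ∃[ x ] f x ≡ y
injective⇒strictlySurjective {suc m} f inj y with any? (λ x → f x ≟ y)
... | yes hit = hit
... | no miss = contradiction (injective⇒≤ {f = λ x → punchOut (y≢f x)} (inj ∘ punchOut-injective (y≢f _) (y≢f _))) 1+n≰n
  where
  y≢f : ∀ x → y ≢ f x
  y≢f x y≡fx = miss (x , sym y≡fx)

-- A choice `g` of preimages is injective because `f` undoes it, hence surjective by counting, hence
-- a two-sided inverse.
strictlySurjective⇒permutation : ∀ {m} (f : Fin m → Fin m) → (∀ y → ∃[ x ] f x ≡ y) → Permutation′ m
strictlySurjective⇒permutation f surj = permutation f g (proj₂ ∘ surj) g∘f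
  where
  g = proj₁ ∘ surj
  g∘f : ∀ x → g (f x) ≡ x
  g∘f x with injective⇒strictlySurjective g
               (λ {y} {z} e → trans (sym (proj₂ (surj y))) (trans (cong f e) (proj₂ (surj z)))) x
  ... | y , refl = cong g (proj₂ (surj y))

-- Counting takes the place of linear algebra over F₂: each cube of bits is coded by a number below
-- a power of two. The codes also turn pointwise equality into `_≡_`, so that the pigeonhole
-- principle applies.
cube-injective⇒surjective : ∀ {m k} → m ≡ k → (Φ : (Fin m → Bool) → (Fin k → Bool)) →
  (∀ f g → Φ f ≗ Φ g → f ≗ g) → ∀ t → ∃[ f ] Φ f ≗ t
cube-injective⇒surjective {m} refl Φ inj t =
  dec (proj₁ hit) , λ i → trans (sym (dec-enc _ i)) (trans (cong (λ k → dec k i) (proj₂ hit)) (dec-enc t i))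
  where
  open Inverse 2↔Bool
  enc : (Fin m → Bool) → Fin (2 ^ m)
  enc f = funToFin (from ∘ f)
  dec : Fin (2 ^ m) → (Fin m → Bool)
  dec k = to ∘ finToFun k
  dec-enc : ∀ f → dec (enc f) ≗ f
  dec-enc f i = trans (cong to (finToFun-funToFin (from ∘ f) i)) (strictlyInverseˡ (f i))
  dec-injective : ∀ {k l} → dec k ≗ dec l → k ≡ l
  dec-injective {k} {l} e = begin
    k                              ≡⟨ funToFin-finToFin {m} {2} k ⟨
    funToFin (finToFun {2} {m} k)  ≡⟨ funToFin-cong same-digits ⟩
    funToFin (finToFun {2} {m} l)  ≡⟨ funToFin-finToFin {m} {2} l ⟩
    l                              ∎
    where
    same-digits : finToFun {2} {m} k ≗ finToFun {2} {m} l
    same-digits i = trans (sym (strictlyInverseʳ _)) (trans (cong from (e i)) (strictlyInverseʳ _))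
    funToFin-cong : ∀ {m n} {f g : Fin m → Fin n} → f ≗ g → funToFin f ≡ funToFin g
    funToFin-cong {zero}  e = refl
    funToFin-cong {suc m} e = cong₂ combine (e zero) (funToFin-cong (e ∘ suc))
  hit = injective⇒strictlySurjective (enc ∘ Φ ∘ dec)
    (λ e → dec-injective (inj _ _ λ i → trans (sym (dec-enc _ i)) (trans (cong (λ k → dec k i) e) (dec-enc _ i))))
    (enc t)

xor≡false⇒≡ : ∀ {a b} → a xor b ≡ false → a ≡ b
xor≡false⇒≡ {false} {false} _ = refl
xor≡false⇒≡ {true}  {true}  _ = refl

≡⇒xor≡false : ∀ {a b} → a ≡ b → a xor b ≡ false
≡⇒xor≡false {a} refl = xor-same a

-- Chains, potentials and crossings modulo 2

δ : ∀ {m} → Fin m → Fin m → Bool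
δ i j = does (i ≟ j)

sum-δ : ∀ {m} (f : Fin m → Bool) i → sum (λ j → f j ∧ δ i j) ≡ f i
sum-δ {suc m} f zero = trans
  (cong₂ _xor_ (∧-identityʳ (f zero)) (trans (sum-cong-≗ (λ j → ∧-zeroʳ (f (suc j)))) (sum-replicate-zero m)))
  (xor-identityʳ (f zero))
sum-δ {suc m} f (suc i) = cong₂ _xor_ (∧-zeroʳ (f zero)) (sum-δ (f ∘ suc) i)

Cochain : ℕ → Set
Cochain m = Fin m → Fin m → Bool

-- The sum of the two orientations makes the indicator symmetric.
edge : ∀ {m} → Fin m → Fin m → Cochain m
edge i j u w = (δ i u ∧ δ j w) xor (δ j u ∧ δ i w)

-- An edge walked twice cancels. The relation `T` is arbitrary so that the same function serves
-- walks in the graph and walks in a small model on `Fin m`, where its values can be computed.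
chain : ∀ {m} {T : Rel (Fin m) 0ℓ} {i j} → Star T i j → Cochain m
chain ε                   u w = false
chain (_◅_ {i} {j} _ wlk) u w = edge i j u w xor chain wlk u w

edge-sym : ∀ {m} (i j u w : Fin m) → edge i j u w ≡ edge i j w u
edge-sym i j u w = trans (xor-comm (δ i u ∧ δ j w) _) (cong₂ _xor_ (∧-comm (δ j u) _) (∧-comm (δ i u) _))

chain-sym : ∀ {m} {T : Rel (Fin m) 0ℓ} {i j} (wlk : Star T i j) u w → chain wlk u w ≡ chain wlk w u
chain-sym ε                   u w = refl
chain-sym (_◅_ {i} {j} _ wlk) u w = cong₂ _xor_ (edge-sym i j u w) (chain-sym wlk u w)

module _ {m m′} {T : Rel (Fin m) 0ℓ} {T′ : Rel (Fin m′) 0ℓ} (κ : Fin m → Fin m′)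
  (mono : ∀ {i j} → T i j → T′ (κ i) (κ j)) where

  -- This carries values computed in the model over to the graph; `chain-off-image` covers the
  -- vertices that the model does not reach.
  chain-gmap : Injective _≡_ _≡_ κ → ∀ {i j} (wlk : Star T i j) k l →
    chain (gmap {T = T} {U = T′} κ mono wlk) (κ k) (κ l) ≡ chain wlk k l
  chain-gmap inj ε k l = refl
  chain-gmap inj (_◅_ {i} {j} _ wlk) k l =
    cong₂ _xor_ (cong₂ _xor_ (cong₂ _∧_ (δ-map i k) (δ-map j l)) (cong₂ _∧_ (δ-map j k) (δ-map i l)))
      (chain-gmap inj wlk k l)
    where
    δ-map : ∀ p q → δ (κ p) (κ q) ≡ δ p q
    δ-map p q with p ≟ q
    ... | yes refl = dec-true (κ p ≟ κ p) refl
    ... | no p≢q   = dec-false (κ p ≟ κ q) (p≢q ∘ inj)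

  chain-off-image : ∀ {i j} (wlk : Star T i j) v u → (∀ k → κ k ≢ u) →
    chain (gmap {T = T} {U = T′} κ mono wlk) v u ≡ false
  chain-off-image ε v u off = refl
  chain-off-image (_◅_ {i} {j} _ wlk) v u off =
    cong₂ _xor_ (cong₂ _xor_ (vanish (κ i) j) (vanish (κ j) i)) (chain-off-image wlk v u off)
    where
    vanish : ∀ x k → δ x v ∧ δ (κ k) u ≡ false
    vanish x k = trans (cong (δ x v ∧_) (dec-false (κ k ≟ u) (off k))) (∧-zeroʳ _)

-- Cycles and face colorings of a spherical embedding

module Homology (G : Graph) (S : SphericalEmbedding G) {o o′ : Graph.Vertex G} (o~o′ : Graph._~_ G o o′) where
  open Graph G
  open SphericalEmbedding S

  f₀ : Fin faceCount
  f₀ = face o~o′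

  -- The junk value f₀ on non-edges is never used.
  side : Vertex → Vertex → Fin faceCount
  side u v with u ~? v
  ... | yes p = face p
  ... | no _  = f₀

  side-~ : ∀ {u v} (p : u ~ v) → side u v ≡ face p
  side-~ {u} {v} p with u ~? v
  -- `face` takes a proof of adjacency; an orbit path of zero steps shows that its value does not
  -- depend on the proof.
  ... | yes q = Equivalence.from (face-orbit q p) (0 , refl)
  ... | no ¬p = contradiction p ¬p

  side-next : ∀ {u v} → u ~ v → side u v ≡ side v (next v u)
  side-next p = trans (side-~ p) (trans (Equivalence.from (face-orbit p q) (1 , refl)) (sym (side-~ q)))
    where q = next-~ (~-sym p)

  -- The mod 2 boundary: the parity of the degree of `v` in the edge set `φ`. Values of `φ` at
  -- non-adjacent pairs are masked.
  ∂ : Cochain n → Vertex → Bool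
  ∂ φ v = sum (λ u → does (v ~? u) ∧ φ v u)

  ∂-cong : ∀ {φ ψ} → (∀ {u w} → u ~ w → φ u w ≡ ψ u w) → ∀ v → ∂ φ v ≡ ∂ ψ v
  ∂-cong {φ} {ψ} e v = sum-cong-≗ pointwise
    where
    pointwise : ∀ u → does (v ~? u) ∧ φ v u ≡ does (v ~? u) ∧ ψ v u
    pointwise u with v ~? u
    ... | yes p = e p
    ... | no _  = refl

  ∂-xor : ∀ φ ψ v → ∂ (λ u w → φ u w xor ψ u w) v ≡ ∂ φ v xor ∂ ψ v
  ∂-xor φ ψ v = trans (sum-cong-≗ (λ u → ∧-distribˡ-xor (does (v ~? u)) (φ v u) (ψ v u)))
    (∑-distrib-+ (λ u → does (v ~? u) ∧ φ v u) (λ u → does (v ~? u) ∧ ψ v u))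

  ∂-zero : ∀ v → ∂ (λ _ _ → false) v ≡ false
  ∂-zero v = trans (sum-cong-≗ (λ u → ∧-zeroʳ (does (v ~? u)))) (sum-replicate-zero n)

  ∂-edge : ∀ {a b} → a ~ b → ∀ v → ∂ (edge a b) v ≡ δ a v xor δ b v
  ∂-edge {a} {b} p v = begin
    ∂ (edge a b) v                        ≡⟨ ∂-xor (λ u w → δ a u ∧ δ b w) (λ u w → δ b u ∧ δ a w) v ⟩
    half a b xor half b a                 ≡⟨ cong₂ _xor_ (half≡ p) (half≡ (~-sym p)) ⟩
    δ a v xor δ b v                       ∎
    where
    half : Vertex → Vertex → Bool
    half c d = ∂ (λ u w → δ c u ∧ δ d w) v
    half≡ : ∀ {c d} → c ~ d → half c d ≡ δ c v
    half≡ {c} {d} q = trans (sum-cong-≗ (λ u → sym (∧-assoc (does (v ~? u)) _ _)))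
      (trans (sum-δ (λ u → does (v ~? u) ∧ δ c v) d) absorb)
      where
      absorb : does (v ~? d) ∧ δ c v ≡ δ c v
      absorb with c ≟ v
      ... | yes refl = cong (_∧ true) (dec-true (c ~? d) q)
      ... | no _     = ∧-zeroʳ _

  ∂-chain : ∀ {a b} (wlk : Star _~_ a b) v → ∂ (chain wlk) v ≡ δ a v xor δ b v
  ∂-chain {a} ε v = trans (∂-zero v) (sym (xor-same (δ a v)))
  ∂-chain {a} {b} (_◅_ {j = c} p wlk) v = begin
    ∂ (chain (p ◅ wlk)) v                          ≡⟨ ∂-xor (edge a c) (chain wlk) v ⟩
    ∂ (edge a c) v xor ∂ (chain wlk) v             ≡⟨ cong₂ _xor_ (∂-edge p v) (∂-chain wlk v) ⟩
    (δ a v xor δ c v) xor (δ c v xor δ b v)        ≡⟨ xor-assoc (δ a v) (δ c v) _ ⟩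
    δ a v xor (δ c v xor (δ c v xor δ b v))        ≡⟨ cong (δ a v xor_) (sym (xor-assoc (δ c v) _ _)) ⟩
    δ a v xor ((δ c v xor δ c v) xor δ b v)        ≡⟨ cong (λ t → δ a v xor (t xor δ b v)) (xor-same (δ c v)) ⟩
    δ a v xor δ b v                                ∎

  -- The coboundary of the face coloring `c` in the dual graph, read as a set of edges of the graph
  -- itself.
  jump : (Fin faceCount → Bool) → Cochain n
  jump c u v = c (side u v) xor c (side v u)

  iterate-next-~ : ∀ {v u} k → v ~ u → v ~ iterate (next v) u k
  iterate-next-~ zero    p = p
  iterate-next-~ (suc k) p = iterate-next-~ k (next-~ p)

  -- `next v` is only known to permute the neighbors of `v`. Fixing all other vertices gives a
  -- permutation of the whole vertex set, under which sums over all vertices can be reindexed.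
  rotate : Vertex → Vertex → Vertex
  rotate v u = if does (v ~? u) then next v u else u

  rotate-~ : ∀ {v u} → v ~ u → rotate v u ≡ next v u
  rotate-~ {v} {u} p rewrite dec-true (v ~? u) p = refl

  iterate-shift : ∀ {A : Set} (f : A → A) x k → iterate f (f x) k ≡ f (iterate f x k)
  iterate-shift f x zero    = refl
  iterate-shift f x (suc k) = iterate-shift f (f x) k

  rotate-surjective : ∀ v w → ∃[ u ] rotate v u ≡ w
  rotate-surjective v w with v ~? w in eq
  ... | no ¬p = w , lemma
    where
    lemma : rotate v w ≡ w
    lemma rewrite eq = refl
  -- The rotation started one step after `w` comes back to `w`; the vertex just before that return
  -- is the preimage.
  ... | yes p with cyclic (next-~ p) p
  ...   | k , e = iterate (next v) w k ,
    trans (rotate-~ (iterate-next-~ k p)) (trans (sym (iterate-shift (next v) w k)) e)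

  -- Around v the terms of the two sums are permuted by the rotation.
  ∂-jump : ∀ c v → ∂ (jump c) v ≡ false
  ∂-jump c v = begin
    ∂ (jump c) v
      ≡⟨ ∂-xor (λ u w → c (side u w)) (λ u w → c (side w u)) v ⟩
    sum out xor ∂ (λ u w → c (side w u)) v
      ≡⟨ cong (sum out xor_) (sum-cong-≗ out-rotate) ⟨
    sum out xor sum (λ u → out (rotate v u))
      ≡⟨ cong (_xor sum (λ u → out (rotate v u))) (sum-permute out rotation) ⟩
    sum (λ u → out (rotate v u)) xor sum (λ u → out (rotate v u))
      ≡⟨ xor-same (sum (λ u → out (rotate v u))) ⟩
    false ∎
    where
    rotation : Permutation′ n
    rotation = strictlySurjective⇒permutation (rotate v) (rotate-surjective v)
    out : Vertex → Bool
    out u = does (v ~? u) ∧ c (side v u)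
    out-rotate : ∀ u → out (rotate v u) ≡ does (v ~? u) ∧ c (side u v)
    out-rotate u with v ~? u in eq
    ... | yes p rewrite dec-true (v ~? next v u) (next-~ p) = cong c (sym (side-next (~-sym p)))
    ... | no ¬p rewrite dec-false (v ~? u) ¬p = refl

  -- One turn about `v` crosses the edge to `u`: the new face is `side u v`, by `side-next`.
  jump-rotate : ∀ c {v u} → v ~ u → c (side v (next v u)) ≡ c (side v u) xor jump c v u
  jump-rotate c {v} {u} p = begin
    c (side v (next v u))                              ≡⟨ cong c (side-next (~-sym p)) ⟨
    c (side u v)                                       ≡⟨ cong (_xor c (side u v)) (xor-same (c (side v u))) ⟨
    (c (side v u) xor c (side v u)) xor c (side u v)   ≡⟨ xor-assoc (c (side v u)) _ _ ⟩
    c (side v u) xor jump c v u                        ∎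

  Clear : (Fin faceCount → Bool) → Vertex → Set
  Clear c v = ∀ {u} → v ~ u → jump c v u ≡ false

  -- The rotation about `v` leads from any neighbor to any other, and by `jump-rotate` no turn
  -- changes the value.
  clear-const : ∀ c v → Clear c v → ∀ {u w} → v ~ u → v ~ w → c (side v u) ≡ c (side v w)
  clear-const c v clear {u} {w} p q with cyclic p q
  ... | k , e = go k p e
    where
    go : ∀ k {u} → v ~ u → iterate (next v) u k ≡ w → c (side v u) ≡ c (side v w)
    go zero    p refl = refl
    go (suc k) p e    = trans (sym (trans (jump-rotate c p) (trans (cong (c _ xor_) (clear p)) (xor-identityʳ _))))
      (go k (next-~ p) e)

  -- This computes the kernel of `jump`. Every face borders some edge, and the value is carried
  -- along a walk joining two such edges, both around its vertices and across its edges.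
  clear-everywhere⇒const : ∀ c → (∀ v → Clear c v) → ∀ i j → c i ≡ c j
  clear-everywhere⇒const c clear i j with face-onto i | face-onto j
  ... | u , v , p , refl | u′ , v′ , p′ , refl =
    trans (sym (cong c (side-~ p))) (trans (go (connected u u′) p p′) (cong c (side-~ p′)))
    where
    go : ∀ {u u′ v v′} → Star _~_ u u′ → u ~ v → u′ ~ v′ → c (side u v) ≡ c (side u′ v′)
    go {u} ε p p′ = clear-const c u (clear u) p p′
    go {u} (q ◅ r) p p′ = trans (clear-const c u (clear u) p q) (trans (xor≡false⇒≡ (clear u q)) (go r (~-sym q) p′))

  -- One path from the base point `o` to each vertex of `h`, summed: a right inverse of `∂` away
  -- from `o`.
  spread : (Vertex → Bool) → Cochain n
  spread h u w = sum (λ z → h z ∧ chain (connected o z) u w)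

  ∂-spread : ∀ h {v} → v ≢ o → ∂ (spread h) v ≡ h v
  ∂-spread h {v} v≢o = begin
    sum (λ u → does (v ~? u) ∧ sum (λ z → h z ∧ P z u))
      ≡⟨ sum-cong-≗ (λ u → ∧-distribˡ-sum (does (v ~? u)) (λ z → h z ∧ P z u)) ⟩
    sum (λ u → sum (λ z → does (v ~? u) ∧ (h z ∧ P z u)))
      ≡⟨ ∑-comm (λ u z → does (v ~? u) ∧ (h z ∧ P z u)) ⟩
    sum (λ z → sum (λ u → does (v ~? u) ∧ (h z ∧ P z u)))
      ≡⟨ sum-cong-≗ (λ z → trans (sum-cong-≗ (λ u → x∧yz≡y∧xz (does (v ~? u)) (h z) (P z u)))
                                 (sym (∧-distribˡ-sum (h z) (λ u → does (v ~? u) ∧ P z u)))) ⟩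
    sum (λ z → h z ∧ ∂ (chain (connected o z)) v)
      ≡⟨ sum-cong-≗ (λ z → cong (h z ∧_) (∂-path z)) ⟩
    sum (λ z → h z ∧ δ v z)
      ≡⟨ sum-δ h v ⟩
    h v ∎
    where
    P : Vertex → Vertex → Bool
    P z u = chain (connected o z) v u
    ∧-distribˡ-sum : ∀ {m} b (f : Fin m → Bool) → b ∧ sum f ≡ sum (λ i → b ∧ f i)
    ∧-distribˡ-sum {m} false f = sym (sum-replicate-zero m)
    ∧-distribˡ-sum     true  f = refl
    δ-sym : ∀ {m} (i j : Fin m) → δ i j ≡ δ j i
    δ-sym i j with i ≟ j
    ... | yes refl = sym (dec-true (i ≟ i) refl)
    ... | no i≢j   = sym (dec-false (j ≟ i) (i≢j ∘ sym))
    ∂-path : ∀ z → ∂ (chain (connected o z)) v ≡ δ v z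
    ∂-path z = trans (∂-chain (connected o z) v)
      (trans (cong (_xor δ z v) (dec-false (o ≟ v) (v≢o ∘ sym))) (δ-sym z v))

  spread-zero : ∀ {h} → (∀ v → h v ≡ false) → ∀ u w → spread h u w ≡ false
  spread-zero {h} h≡0 u w =
    trans (sum-cong-≗ (λ z → cong (_∧ chain (connected o z) u w) (h≡0 z))) (sum-replicate-zero n)

  -- The first summand is always a cycle, and the second realises any prescribed boundary away from
  -- `o`; the dimension count will show that together they give every symmetric cochain on the
  -- edges.
  cochain : (Fin faceCount → Bool) → (Vertex → Bool) → Cochain n
  cochain c h u w = jump c u w xor spread h u w

  -- The boundary sees only the spread part, so a cycle has none.
  cycle⇒spread-trivial : ∀ c h (φ : Cochain n) → (∀ {u w} → u ~ w → cochain c h u w ≡ φ u w) →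
    (∀ v → ∂ φ v ≡ false) → h o ≡ false → ∀ v → h v ≡ false
  cycle⇒spread-trivial c h φ e ∂φ ho v with v ≟ o
  ... | yes refl = ho
  ... | no v≢o = begin
    h v                               ≡⟨ ∂-spread h v≢o ⟨
    ∂ (spread h) v                    ≡⟨ cong (_xor ∂ (spread h) v) (∂-jump c v) ⟨
    ∂ (jump c) v xor ∂ (spread h) v   ≡⟨ ∂-xor (jump c) (spread h) v ⟨
    ∂ (cochain c h) v                 ≡⟨ ∂-cong e v ⟩
    ∂ φ v                             ≡⟨ ∂φ v ⟩
    false                             ∎

  cycle⇒cochain≡jump : ∀ c h (φ : Cochain n) → (∀ {u w} → u ~ w → cochain c h u w ≡ φ u w) →
    (∀ v → ∂ φ v ≡ false) → h o ≡ false → ∀ {u w} → u ~ w → jump c u w ≡ φ u w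
  cycle⇒cochain≡jump c h φ e ∂φ ho {u} {w} p =
    trans (sym (xor-identityʳ _))
      (trans (cong (jump c u w xor_) (sym (spread-zero (cycle⇒spread-trivial c h φ e ∂φ ho) u w))) (e p))

  -- The zero cochain is a cycle, so `h` vanishes, and then `c` has no jumps and is constant. The
  -- two bits fix what this leaves open: the constant, and `h` at the base point, where `∂-spread`
  -- says nothing.
  cochain-kernel : ∀ c h → (∀ {u w} → u ~ w → cochain c h u w ≡ false) → c f₀ ≡ false → h o ≡ false →
    (∀ i → c i ≡ false) × (∀ v → h v ≡ false)
  cochain-kernel c h e cf ho =
      (λ i → trans (clear-everywhere⇒const c (λ v → cycle⇒cochain≡jump c h (λ _ _ → false) e ∂-zero ho) i f₀) cf)
    , cycle⇒spread-trivial c h (λ _ _ → false) e ∂-zero ho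

  cochain-xor : ∀ c h c′ h′ u w →
    cochain (λ i → c i xor c′ i) (λ v → h v xor h′ v) u w ≡ cochain c h u w xor cochain c′ h′ u w
  cochain-xor c h c′ h′ u w = trans
    (cong₂ _xor_ (xor-interchange (c (side u w)) _ _ _)
      (trans (sum-cong-≗ (λ z → ∧-distribʳ-xor (chain (connected o z) u w) (h z) (h′ z)))
        (∑-distrib-+ (λ z → h z ∧ chain (connected o z) u w) (λ z → h′ z ∧ chain (connected o z) u w))))
    (xor-interchange (jump c u w) _ _ _)

  -- This list has length `edgeCount G` by definition, so `Fin (edgeCount G)` indexes it. It holds
  -- only ascending pairs, which is why cochains are compared under a symmetry assumption.
  edges : List (Vertex × Vertex)
  edges = filter (λ (u , v) → (u <? v) ×-dec (u ~? v)) (cartesianProduct (allFin n) (allFin n))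

  at : Cochain n → Fin (edgeCount G) → Bool
  at φ i = φ (proj₁ (lookup edges i)) (proj₂ (lookup edges i))

  agree-upwards : ∀ (φ ψ : Cochain n) → (∀ i → at φ i ≡ at ψ i) → ∀ {u w} → u < w → u ~ w → φ u w ≡ ψ u w
  agree-upwards φ ψ e lt p = subst (λ (u , w) → φ u w ≡ ψ u w) (sym (lookup-index d∈)) (e (index d∈))
    where
    d∈ = ∈-filter⁺ (λ (u , v) → (u <? v) ×-dec (u ~? v))
      (∈-cartesianProduct⁺ (∈-allFin _) (∈-allFin _)) (lt , p)

  agree-on-edges : ∀ {φ ψ : Cochain n} → (∀ u w → φ u w ≡ φ w u) → (∀ u w → ψ u w ≡ ψ w u) →
    (∀ i → at φ i ≡ at ψ i) → ∀ {u w} → u ~ w → φ u w ≡ ψ u w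
  agree-on-edges {φ} {ψ} φ-sym ψ-sym e {u} {w} p with <-cmp u w
  ... | tri< u<w _ _  = agree-upwards φ ψ e u<w p
  ... | tri≈ _ refl _ = contradiction p (~-irrefl refl)
  ... | tri> _ _ w<u  = trans (φ-sym u w) (trans (agree-upwards φ ψ e w<u (~-sym p)) (ψ-sym w u))

  spread-sym : ∀ h u w → spread h u w ≡ spread h w u
  spread-sym h u w = sum-cong-≗ (λ z → cong (h z ∧_) (chain-sym (connected o z) u w))

  cochain-sym : ∀ c h u w → cochain c h u w ≡ cochain c h w u
  cochain-sym c h u w = cong₂ _xor_ (xor-comm (c (side u w)) _) (spread-sym h u w)

  -- Planar duality: `φ` is the boundary of the set of faces where `value` is true.
  record Potential (φ : Cochain n) : Set where
    constructor potential
    field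
      value : Fin faceCount → Bool
      jumps : ∀ {u w} → u ~ w → jump value u w ≡ φ u w

  -- Pairs (c , h) form an F₂-space of dimension F + V, while cochains together
  -- with the two normalising bits c f₀ and h o form one of dimension E + 2. By
  -- Euler's formula the injection below is therefore a bijection.
  cycle-potential : ∀ (φ : Cochain n) → (∀ u w → φ u w ≡ φ w u) → (∀ v → ∂ φ v ≡ false) → Potential φ
  cycle-potential φ φ-sym ∂φ = potential (left x)
    (cycle⇒cochain≡jump (left x) (right x) φ on-φ ∂φ
      (trans (sym (Φ-bit x 1F)) (trans (hit (edgeCount G ↑ʳ 1F)) (target-bit 1F))))
    where
    m : ℕ
    m = faceCount + n

    left : (Fin m → Bool) → Fin faceCount → Bool
    left x i = x (i ↑ˡ n)

    right : (Fin m → Bool) → Vertex → Bool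
    right x v = x (faceCount ↑ʳ v)

    bits : (Fin m → Bool) → Fin 2 → Bool
    bits x 0F = left x f₀
    bits x 1F = right x o

    Φ : (Fin m → Bool) → (Fin (edgeCount G + 2) → Bool)
    Φ x = [ at (cochain (left x) (right x)) , bits x ]′ ∘ splitAt (edgeCount G)

    Φ-edge : ∀ x e → Φ x (e ↑ˡ 2) ≡ at (cochain (left x) (right x)) e
    Φ-edge x e = cong [ at (cochain (left x) (right x)) , bits x ]′ (splitAt-↑ˡ (edgeCount G) e 2)

    Φ-bit : ∀ x b → Φ x (edgeCount G ↑ʳ b) ≡ bits x b
    Φ-bit x b = cong [ at (cochain (left x) (right x)) , bits x ]′ (splitAt-↑ʳ (edgeCount G) 2 b)

    Φ-injective : ∀ x y → Φ x ≗ Φ y → x ≗ y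
    Φ-injective x y e i = trans (cong x (sym (join-splitAt faceCount n i)))
      (trans (parts (splitAt faceCount i)) (cong y (join-splitAt faceCount n i)))
      where
      on-edges : ∀ {u w} → u ~ w → cochain (λ i → left x i xor left y i) (λ v → right x v xor right y v) u w ≡ false
      on-edges {u} {w} p = trans (cochain-xor (left x) (right x) (left y) (right y) u w)
        (≡⇒xor≡false (agree-on-edges (cochain-sym (left x) (right x)) (cochain-sym (left y) (right y))
          (λ i → trans (sym (Φ-edge x i)) (trans (e _) (Φ-edge y i))) p))
      on-bit : ∀ b → bits x b xor bits y b ≡ false
      on-bit b = ≡⇒xor≡false (trans (sym (Φ-bit x b)) (trans (e _) (Φ-bit y b)))
      kernel = cochain-kernel (λ i → left x i xor left y i) (λ v → right x v xor right y v)
        on-edges (on-bit 0F) (on-bit 1F)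
      parts : ∀ s → x (join faceCount n s) ≡ y (join faceCount n s)
      parts (inj₁ i) = xor≡false⇒≡ (proj₁ kernel i)
      parts (inj₂ v) = xor≡false⇒≡ (proj₂ kernel v)

    -- Both normalising bits are required to vanish; the one for `h o` lets the path part of the
    -- solution be discarded when `φ` is a cycle.
    target : Fin (edgeCount G + 2) → Bool
    target = [ at φ , (λ _ → false) ]′ ∘ splitAt (edgeCount G)

    target-bit : ∀ b → target (edgeCount G ↑ʳ b) ≡ false
    target-bit b = cong [ at φ , (λ _ → false) ]′ (splitAt-↑ʳ (edgeCount G) 2 b)

    solution = cube-injective⇒surjective (trans (+-comm faceCount n) euler) Φ Φ-injective target
    x = proj₁ solution
    hit = proj₂ solution

    on-φ : ∀ {u w} → u ~ w → cochain (left x) (right x) u w ≡ φ u w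
    on-φ = agree-on-edges (cochain-sym (left x) (right x)) φ-sym
      (λ i → trans (sym (Φ-edge x i)) (trans (hit (i ↑ˡ 2))
        (cong [ at φ , (λ _ → false) ]′ (splitAt-↑ˡ (edgeCount G) i 2))))

  closed-walk-potential : ∀ {v} (wlk : Star _~_ v v) → Potential (chain wlk)
  closed-walk-potential {v} wlk =
    cycle-potential (chain wlk) (chain-sym wlk) (λ u → trans (∂-chain wlk u) (xor-same (δ v u)))

-- Crossing chords of a cycle

module Crossing (G : Graph) (S : SphericalEmbedding G) {o o′ : Graph.Vertex G} (o~o′ : Graph._~_ G o o′) where
  open Graph G
  open SphericalEmbedding S
  open Homology G S o~o′
  open Potential

  x≢x-xor-true : ∀ x → x ≢ x xor true
  x≢x-xor-true false ()
  x≢x-xor-true true  ()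

  flipped-once : ∀ {x y} → y ≡ x xor true → x ≢ y xor false
  flipped-once {false} refl ()
  flipped-once {true}  refl ()

  module Branch (c c′ : Fin faceCount → Bool) {v a b p : Vertex} (v~a : v ~ a) (v~b : v ~ b) (v~p : v ~ p)
    (rest : ∀ {u} → v ~ u → u ≢ a → u ≢ b → u ≢ p → jump c v u ≡ false × jump c′ v u ≡ false) where

    IsBranch : Vertex → Set
    IsBranch y = y ≡ a ⊎ y ≡ b ⊎ y ≡ p

    -- Rotating on from `s`, no edge before the first branch neighbor changes either coloring, so
    -- the values there are those just past the edge to `s`. The search ends because the rotation
    -- reaches `a`.
    next-branch : ∀ {s j j′} → v ~ s → jump c v s ≡ j → jump c′ v s ≡ j′ →
      ∃[ y ] (IsBranch y × c (side v y) ≡ c (side v s) xor j × c′ (side v y) ≡ c′ (side v s) xor j′)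
    next-branch v~s refl refl with cyclic (next-~ v~s) v~a
    ... | k , e with ahead k (next-~ v~s) e
      where
      ahead : ∀ k {u} → v ~ u → iterate (next v) u k ≡ a →
        ∃[ y ] (IsBranch y × c (side v y) ≡ c (side v u) × c′ (side v y) ≡ c′ (side v u))
      ahead zero    {u} v~u refl = u , inj₁ refl , refl , refl
      ahead (suc k) {u} v~u e with u ≟ a | u ≟ b | u ≟ p
      ... | yes u≡a | _       | _       = u , inj₁ u≡a , refl , refl
      ... | no _    | yes u≡b | _       = u , inj₂ (inj₁ u≡b) , refl , refl
      ... | no _    | no _    | yes u≡p = u , inj₂ (inj₂ u≡p) , refl , refl
      ... | no u≢a  | no u≢b  | no u≢p with rest v~u u≢a u≢b u≢p | ahead k (next-~ v~u) e
      ...   | j , j′ | y , y∈ , q , q′ = y , y∈ , trans q (unchanged c j) , trans q′ (unchanged c′ j′)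
        where
        unchanged : ∀ d → jump d v u ≡ false → d (side v (next v u)) ≡ d (side v u)
        unchanged d j = trans (jump-rotate d v~u) (trans (cong (d (side v u) xor_) j) (xor-identityʳ _))
    ... | y , y∈ , q , q′ = y , y∈ , trans q (jump-rotate c v~s) , trans q′ (jump-rotate c′ v~s)

    -- Both cyclic orders of a, b, p around v lead to the same parity.
    branch-parity : jump c v a ≡ true → jump c′ v a ≡ true → jump c v b ≡ true → jump c′ v b ≡ false →
      jump c v p ≡ false → jump c′ v p ≡ true →
      (c (side v a) xor c′ (side v a)) xor c′ (side v b) ≡ not (c (side v p))
    branch-parity ja ja′ jb jb′ jp jp′ with next-branch v~a ja ja′
    -- Past the edge to `a` both colorings have flipped, so the next branch neighbor is not `a`. Nor
    -- is `a` the one after that: one of the colorings would return to its value at `a` after a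
    -- single flip.
    ... | _ , inj₁ refl , q , _ = contradiction q (x≢x-xor-true _)
    ... | _ , inj₂ (inj₁ refl) , q , q′ with next-branch v~b jb jb′
    ...   | _ , inj₁ refl , _ , r′        = contradiction r′ (flipped-once q′)
    ...   | _ , inj₂ (inj₁ refl) , r , _  = contradiction r (x≢x-xor-true _)
    ...   | _ , inj₂ (inj₂ refl) , r , _  = order₁ (c (side v a)) (c′ (side v a)) q q′ r
      where
      order₁ : ∀ x x′ {y y′ z} → y ≡ x xor true → y′ ≡ x′ xor true → z ≡ y xor true → (x xor x′) xor y′ ≡ not z
      order₁ false false refl refl refl = refl
      order₁ false true  refl refl refl = refl
      order₁ true  false refl refl refl = refl
      order₁ true  true  refl refl refl = refl
    branch-parity ja ja′ jb jb′ jp jp′ | _ , inj₂ (inj₂ refl) , q , q′ with next-branch v~p jp jp′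
    ...   | _ , inj₁ refl , r , _         = contradiction r (flipped-once q)
    ...   | _ , inj₂ (inj₂ refl) , _ , r′ = contradiction r′ (x≢x-xor-true _)
    ...   | _ , inj₂ (inj₁ refl) , _ , r′ = order₂ (c (side v a)) (c′ (side v a)) q q′ r′
      where
      order₂ : ∀ x x′ {y y′ z} → y ≡ x xor true → y′ ≡ x′ xor true → z ≡ y′ xor true → (x xor x′) xor z ≡ not y
      order₂ false false refl refl refl = refl
      order₂ false true  refl refl refl = refl
      order₂ true  false refl refl refl = refl
      order₂ true  true  refl refl refl = refl

  open Branch using (branch-parity)

  jump-xor : ∀ c c′ u w → jump (λ i → c i xor c′ i) u w ≡ jump c u w xor jump c′ u w
  jump-xor c c′ u w = xor-interchange (c (side u w)) (c′ (side u w)) (c (side w u)) (c′ (side w u))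

  clear-across : ∀ c {x y u w} → Clear c x → Clear c y → x ~ y → x ~ u → y ~ w → c (side x u) ≡ c (side y w)
  clear-across c {x} {y} cx cy x~y x~u y~w =
    trans (clear-const c x cx x~u x~y) (trans (xor≡false⇒≡ (cx x~y)) (clear-const c y cy (~-sym x~y) y~w))

  -- Two cycles share an arc leaving v towards a, the first continues from v to b,
  -- the second to p, and w lies on the shared arc with w ~ b. The chord at v
  -- towards p and the chord w b then lie on different sides of the first cycle.
  crossing : ∀ c c′ {v a w b p} → v ~ a → a ~ w → w ~ b → v ~ b → v ~ p →
    (∀ {u} → v ~ u → u ≢ a → u ≢ b → u ≢ p → jump c v u ≡ false × jump c′ v u ≡ false) →
    jump c v a ≡ true → jump c′ v a ≡ true → jump c v b ≡ true → jump c′ v b ≡ false →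
    jump c v p ≡ false → jump c′ v p ≡ true →
    Clear (λ i → c i xor c′ i) a → Clear (λ i → c i xor c′ i) w → Clear c′ b →
    c (side w b) ≡ not (c (side v p))
  crossing c c′ {v} {a} {w} {b} {p} v~a a~w w~b v~b v~p rest ja ja′ jb jb′ jp jp′ clear-a clear-w clear-b = begin
    c (side w b)
      ≡⟨ cancel (c (side w b)) (c′ (side w b)) ⟨
    (c (side w b) xor c′ (side w b)) xor c′ (side w b)
      ≡⟨ cong₂ _xor_ c+c′ c′≡ ⟩
    (c (side v a) xor c′ (side v a)) xor c′ (side v b)
      ≡⟨ branch-parity c c′ v~a v~b v~p rest ja ja′ jb jb′ jp jp′ ⟩
    not (c (side v p)) ∎
    where
    cancel : ∀ x y → (x xor y) xor y ≡ x
    cancel x y = trans (xor-assoc x y y) (trans (cong (x xor_) (xor-same y)) (xor-identityʳ x))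
    -- In the sum of the two cycles the shared arc cancels, so its potential is constant from the
    -- edge `v a` to the edge `w b`. The second cycle avoids `b`, so `c′` is constant around `b`.
    c″ : Fin faceCount → Bool
    c″ i = c i xor c′ i
    c+c′ : c″ (side w b) ≡ c″ (side v a)
    c+c′ = trans (clear-across c″ clear-w clear-a (~-sym a~w) w~b (~-sym v~a)) (xor≡false⇒≡ (clear-a (~-sym v~a)))
    c′≡ : c′ (side w b) ≡ c′ (side v b)
    c′≡ = trans (sym (xor≡false⇒≡ (clear-b (~-sym w~b))))
      (trans (clear-const c′ b clear-b (~-sym w~b) (~-sym v~b)) (xor≡false⇒≡ (clear-b (~-sym v~b))))

  module Model {m} (κ : Fin m → Vertex) (κ-injective : Injective _≡_ _≡_ κ) where

    Link : Rel (Fin m) 0ℓ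
    Link i j = κ i ~ κ j

    infixr 5 _↝⟨_⟩_
    _↝⟨_⟩_ : ∀ i {j k} → Link i j → Star Link j k → Star Link i k
    _ ↝⟨ p ⟩ wlk = p ◅ wlk

    embed : ∀ {i} → Star Link i i → Cochain n
    embed wlk = chain (gmap {T = Link} {U = _~_} κ id wlk)

    potential-of : ∀ {i} (wlk : Star Link i i) → Potential (embed wlk)
    potential-of wlk = closed-walk-potential (gmap {T = Link} {U = _~_} κ id wlk)

    at-model : ∀ {i} (wlk : Star Link i i) k l → embed wlk (κ k) (κ l) ≡ chain wlk k l
    at-model = chain-gmap {T = Link} {T′ = _~_} κ id κ-injective

    off-model : ∀ {i} (wlk : Star Link i i) v u → (∀ k → κ k ≢ u) → embed wlk v u ≡ false
    off-model = chain-off-image {T = Link} {T′ = _~_} κ id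

    clear-row : ∀ {i} (C : Star Link i i) (φ : Potential (embed C)) x →
      (∀ k → chain C x k ≡ false) → Clear (value φ) (κ x)
    clear-row C φ x zeros {u} p with any? (λ k → κ k ≟ u)
    ... | yes (k , refl) = trans (jumps φ p) (trans (at-model C x k) (zeros k))
    ... | no miss        = trans (jumps φ p) (off-model C (κ x) u (λ k e → miss (k , e)))

    clear-sum-row : ∀ {i j} (C : Star Link i i) (C′ : Star Link j j)
      (φ : Potential (embed C)) (φ′ : Potential (embed C′)) x →
      (∀ k → chain C x k ≡ chain C′ x k) → Clear (λ i → value φ i xor value φ′ i) (κ x)
    clear-sum-row C C′ φ φ′ x same {u} p = trans (jump-xor (value φ) (value φ′) (κ x) u)
      (≡⇒xor≡false (trans (jumps φ p) (trans agree (sym (jumps φ′ p)))))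
      where
      agree : embed C (κ x) u ≡ embed C′ (κ x) u
      agree with any? (λ k → κ k ≟ u)
      ... | yes (k , refl) = trans (at-model C x k) (trans (same k) (sym (at-model C′ x k)))
      ... | no miss        =
        trans (off-model C (κ x) u (λ k e → miss (k , e))) (sym (off-model C′ (κ x) u (λ k e → miss (k , e))))

    -- For concrete walks the `True` arguments are settled by evaluation. They say that at `v` only
    -- `a`, `b`, `p` can carry either cycle, that the cycles agree at `a` and at `w`, and that the
    -- second one avoids `b`.
    model-crossing : ∀ {i j} (C : Star Link i i) (C′ : Star Link j j) v a w b p →
      Link v a → Link a w → Link w b → Link v b → Link v p → (φ : Potential (embed C)) →
      {True (all? λ k → (k ≟ a ⊎-dec k ≟ b ⊎-dec k ≟ p) ⊎-dec
                   (chain C v k Bool.≟ false ×-dec chain C′ v k Bool.≟ false))} →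
      {True (all? λ k → chain C a k Bool.≟ chain C′ a k)} →
      {True (all? λ k → chain C w k Bool.≟ chain C′ w k)} →
      {True (all? λ k → chain C′ b k Bool.≟ false)} →
      chain C v a ≡ true → chain C′ v a ≡ true → chain C v b ≡ true → chain C′ v b ≡ false →
      chain C v p ≡ false → chain C′ v p ≡ true →
      value φ (side (κ w) (κ b)) ≡ not (value φ (side (κ v) (κ p)))
    model-crossing C C′ v a w b p v~a a~w w~b v~b v~p φ {rv} {ra} {rw} {rb} Cva C′va Cvb C′vb Cvp C′vp =
      crossing (value φ) (value φ′) v~a a~w w~b v~b v~p rest
        (at-row C φ v~a Cva) (at-row C′ φ′ v~a C′va)
        (at-row C φ v~b Cvb) (at-row C′ φ′ v~b C′vb)
        (at-row C φ v~p Cvp) (at-row C′ φ′ v~p C′vp)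
        (clear-sum-row C C′ φ φ′ a (toWitness ra))
        (clear-sum-row C C′ φ φ′ w (toWitness rw))
        (clear-row C′ φ′ b (toWitness rb))
      where
      φ′ = potential-of C′
      at-row : ∀ {i} (C : Star Link i i) (φ : Potential (embed C)) {k t} →
        Link v k → chain C v k ≡ t → jump (value φ) (κ v) (κ k) ≡ t
      at-row C φ {k} q e = trans (jumps φ q) (trans (at-model C v k) e)
      rest : ∀ {u} → κ v ~ u → u ≢ κ a → u ≢ κ b → u ≢ κ p →
        jump (value φ) (κ v) u ≡ false × jump (value φ′) (κ v) u ≡ false
      rest {u} q u≢a u≢b u≢p with any? (λ k → κ k ≟ u)
      ... | no miss =
          trans (jumps φ q) (off-model C (κ v) u (λ k e → miss (k , e)))
        , trans (jumps φ′ q) (off-model C′ (κ v) u (λ k e → miss (k , e)))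
      ... | yes (k , refl) with toWitness rv k
      ...   | inj₁ (inj₁ refl)        = contradiction refl u≢a
      ...   | inj₁ (inj₂ (inj₁ refl)) = contradiction refl u≢b
      ...   | inj₁ (inj₂ (inj₂ refl)) = contradiction refl u≢p
      ...   | inj₂ (e , e′)           = at-row C φ q e , at-row C′ φ′ q e′

-- Nonplanarity of the subdivided K₃,₃

module _ (G : Graph) where
  open Graph G

  -- K₃,₃ with the edge between κ 0F and κ 2F subdivided by κ 1F. The heptagon
  -- 0 1 2 3 4 5 6 has the pairwise crossing chords 0 4, 2 5 and 3 6, and no two of
  -- them can lie on the same side.
  module _ (κ : Fin 7 → Vertex) (κ-injective : Injective _≡_ _≡_ κ)
    (01~ : κ 0F ~ κ 1F) (12~ : κ 1F ~ κ 2F) (23~ : κ 2F ~ κ 3F) (34~ : κ 3F ~ κ 4F) (45~ : κ 4F ~ κ 5F)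
    (56~ : κ 5F ~ κ 6F) (60~ : κ 6F ~ κ 0F) (04~ : κ 0F ~ κ 4F) (25~ : κ 2F ~ κ 5F) (36~ : κ 3F ~ κ 6F) where

    subdivided-K₃,₃-nonplanar : ¬ Planar G
    subdivided-K₃,₃-nonplanar (inj₁ edgeless) = edgeless _ _ 01~
    subdivided-K₃,₃-nonplanar (inj₂ S) =
      -- Three bits cannot differ pairwise.
      odd _ _ _ chords₁ (trans (two-sided 3F 6F 36~ refl) chords₂)
        (trans chords₃ (cong not (sym (two-sided 2F 5F 25~ refl))))
      where
      open Homology G S 01~
      open Potential
      open Crossing G S 01~
      open Model κ κ-injective

      heptagon : Star Link 0F 0F
      heptagon = 0F ↝⟨ 01~ ⟩ 1F ↝⟨ 12~ ⟩ 2F ↝⟨ 23~ ⟩ 3F ↝⟨ 34~ ⟩ 4F ↝⟨ 45~ ⟩ 5F ↝⟨ 56~ ⟩ 6F ↝⟨ 60~ ⟩ ε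

      φ : Potential (embed heptagon)
      φ = potential-of heptagon

      chord : Fin 7 → Fin 7 → Bool
      chord i j = value φ (side (κ i) (κ j))

      -- Here and in the next two, the second cycle is an arc of the heptagon from `v` to `p` closed
      -- by the chord `v p`. The other chord joins the inner vertex `w` of the arc to `b`, the
      -- vertex just beyond its end `v`.
      chords₁ : chord 2F 5F ≡ not (chord 4F 0F)
      chords₁ = model-crossing heptagon
        (4F ↝⟨ ~-sym 34~ ⟩ 3F ↝⟨ ~-sym 23~ ⟩ 2F ↝⟨ ~-sym 12~ ⟩ 1F ↝⟨ ~-sym 01~ ⟩ 0F ↝⟨ 04~ ⟩ ε)
        4F 3F 2F 5F 0F (~-sym 34~) (~-sym 23~) 25~ 45~ (~-sym 04~) φ refl refl refl refl refl refl

      chords₂ : chord 6F 3F ≡ not (chord 4F 0F)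
      chords₂ = model-crossing heptagon
        (4F ↝⟨ 45~ ⟩ 5F ↝⟨ 56~ ⟩ 6F ↝⟨ 60~ ⟩ 0F ↝⟨ 04~ ⟩ ε)
        4F 5F 6F 3F 0F 45~ 56~ (~-sym 36~) (~-sym 34~) (~-sym 04~) φ refl refl refl refl refl refl

      chords₃ : chord 3F 6F ≡ not (chord 5F 2F)
      chords₃ = model-crossing heptagon
        (5F ↝⟨ ~-sym 45~ ⟩ 4F ↝⟨ ~-sym 34~ ⟩ 3F ↝⟨ ~-sym 23~ ⟩ 2F ↝⟨ 25~ ⟩ ε)
        5F 4F 3F 6F 2F (~-sym 45~) (~-sym 34~) 36~ 56~ (~-sym 25~) φ refl refl refl refl refl refl

      -- The heptagon does not use a chord, so the potential is equal on both sides of it and the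
      -- direction of the chord is immaterial.
      two-sided : ∀ i j → (p : κ i ~ κ j) → chain heptagon i j ≡ false → chord i j ≡ chord j i
      two-sided i j p e = xor≡false⇒≡ (trans (jumps φ p) (trans (at-model heptagon i j) e))

      odd : ∀ x y z → y ≡ not x → z ≡ not x → z ≢ not y
      odd false _ _ refl refl ()
      odd true  _ _ refl refl ()

-- Dominating sets and class sizes

∣p∪q∣≤∣p∣+∣q∣ : ∀ {m} (p q : Subset m) → ∣ p ∪ q ∣ ≤ ∣ p ∣ + ∣ q ∣
∣p∪q∣≤∣p∣+∣q∣ []            []            = z≤n
∣p∪q∣≤∣p∣+∣q∣ (outside ∷ p) (outside ∷ q) = ∣p∪q∣≤∣p∣+∣q∣ p q
∣p∪q∣≤∣p∣+∣q∣ (outside ∷ p) (inside ∷ q)  = ≤-trans (s≤s (∣p∪q∣≤∣p∣+∣q∣ p q)) (≤-reflexive (sym (+-suc ∣ p ∣ ∣ q ∣)))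
∣p∪q∣≤∣p∣+∣q∣ (inside ∷ p)  (outside ∷ q) = s≤s (∣p∪q∣≤∣p∣+∣q∣ p q)
∣p∪q∣≤∣p∣+∣q∣ (inside ∷ p)  (inside ∷ q)  = s≤s (≤-trans (∣p∪q∣≤∣p∣+∣q∣ p q) (+-monoʳ-≤ ∣ p ∣ (m≤n⇒m≤1+n ≤-refl)))

∣⁅x⁆∪p∣≤1+∣p∣ : ∀ {m} (x : Fin m) p → ∣ ⁅ x ⁆ ∪ p ∣ ≤ suc ∣ p ∣
∣⁅x⁆∪p∣≤1+∣p∣ x p = ≤-trans (∣p∪q∣≤∣p∣+∣q∣ ⁅ x ⁆ p) (≤-reflexive (cong (_+ ∣ p ∣) (∣⁅x⁆∣≡1 x)))

∣⁅x⁆∪⁅y⁆∣≤2 : ∀ {m} (x y : Fin m) → ∣ ⁅ x ⁆ ∪ ⁅ y ⁆ ∣ ≤ 2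
∣⁅x⁆∪⁅y⁆∣≤2 x y = ≤-trans (∣⁅x⁆∪p∣≤1+∣p∣ x ⁅ y ⁆) (s≤s (≤-reflexive (∣⁅x⁆∣≡1 y)))

unique⇒≤∣p∣ : ∀ {m k} (xs : Vec (Fin m) k) {p : Subset m} → Unique xs → All (_∈ p) xs → k ≤ ∣ p ∣
unique⇒≤∣p∣ []       []           []            = z≤n
unique⇒≤∣p∣ (x ∷ xs) (x∉ ∷ uniq) (x∈ ∷ xs∈) =
  ≤-trans (s≤s (unique⇒≤∣p∣ xs uniq (All.map (λ (x≢y , y∈) → x∈p∧x≢y⇒x∈p-y y∈ (x≢y ∘ sym)) (All.zip (x∉ , xs∈)))))
    (x∈p⇒∣p-x∣<∣p∣ x∈)

∃-outside-pair : ∀ {m} {p : Subset m} → 3 ≤ ∣ p ∣ → ∀ a b → ∃[ x ] (x ∈ p × x ≢ a × x ≢ b)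
∃-outside-pair {p = p} 3≤ a b with any? (λ x → (x ∈? p) ×-dec (¬? (x ≟ a) ×-dec ¬? (x ≟ b)))
... | yes hit = hit
... | no miss = contradiction (≤-trans (p⊆q⇒∣p∣≤∣q∣ covered) (∣⁅x⁆∪⁅y⁆∣≤2 a b)) (<⇒≱ 3≤)
  where
  covered : p ⊆ ⁅ a ⁆ ∪ ⁅ b ⁆
  covered {x} x∈ with x ≟ a | x ≟ b
  ... | yes refl | _        = x∈p∪q⁺ (inj₁ (x∈⁅x⁆ x))
  ... | no _     | yes refl = x∈p∪q⁺ (inj₂ (x∈⁅x⁆ x))
  ... | no x≢a   | no x≢b   = contradiction (x , x∈ , x≢a , x≢b) miss

covering-pair : ∀ {m} (p : Subset m) → Fin m → ∣ p ∣ ≤ 2 → ∃₂ λ a b → ∀ {x} → x ∈ p → x ≡ a ⊎ x ≡ b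
covering-pair p d ∣p∣≤2 with nonempty? p
-- `d` only supplies names to return when there is no element; a singleton is covered by its element
-- taken twice.
... | no empty = d , d , λ x∈ → contradiction (_ , x∈) empty
... | yes (a , a∈) with any? (λ b → (b ∈? p) ×-dec ¬? (b ≟ a))
...   | no miss = a , a , λ {x} x∈ → inj₁ (decidable-stable (x ≟ a) λ x≢a → miss (x , x∈ , x≢a))
...   | yes (b , b∈ , b≢a) = a , b , cover
  where
  cover : ∀ {x} → x ∈ p → x ≡ a ⊎ x ≡ b
  cover {x} x∈ with x ≟ a | x ≟ b
  ... | yes x≡a | _       = inj₁ x≡a
  ... | no _    | yes x≡b = inj₂ x≡b
  ... | no x≢a  | no x≢b  = contradiction
    (unique⇒≤∣p∣ (x ∷ a ∷ b ∷ []) ((x≢a ∷ x≢b ∷ []) ∷ ((b≢a ∘ sym) ∷ []) ∷ [] ∷ []) (x∈ ∷ a∈ ∷ b∈ ∷ []))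
    (<⇒≱ (s≤s ∣p∣≤2))

subset : ∀ {m} {P : Pred (Fin m) 0ℓ} → Decidable P → Subset m
subset P? = Vec.tabulate (does ∘ P?)

-- This ties `classSize`, a count along `Vec.allFin`, to the cardinality of subsets. The induction
-- needs an arbitrary tabulated `f` in place of `id`.
∣subset∣ : ∀ {m} {P : Pred (Fin m) 0ℓ} (P? : Decidable P) → ∣ subset P? ∣ ≡ Vec.count P? (Vec.allFin m)
∣subset∣ {m} P? = go id
  where
  go : ∀ {k} (f : Fin k → Fin m) → ∣ Vec.tabulate (does ∘ P? ∘ f) ∣ ≡ Vec.count P? (Vec.tabulate f)
  go {zero}  f = refl
  go {suc k} f with does (P? (f zero))
  ... | true  = cong suc (go (f ∘ suc))
  ... | false = go (f ∘ suc)

∈-subset⁺ : ∀ {m} {P : Pred (Fin m) 0ℓ} (P? : Decidable P) {x} → P x → x ∈ subset P?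
∈-subset⁺ P? {x} px = lookup⇒[]= x _ (trans (lookup∘tabulate _ x) (dec-true (P? x) px))

∈-subset⁻ : ∀ {m} {P : Pred (Fin m) 0ℓ} (P? : Decidable P) {x} → x ∈ subset P? → P x
∈-subset⁻ P? {x} x∈ with P? x in eq
... | yes px = px
... | no ¬px with () ← trans (sym (trans (lookup∘tabulate (does ∘ P?) x) (cong does eq))) ([]=⇒lookup x∈)

module _ (G : Graph) where
  open Graph G

  Undominated : Vertex → Vertex → Pred Vertex 0ℓ
  Undominated a b v = v ≢ a × v ≢ b × ¬ a ~ v × ¬ b ~ v

  ∃-undominated⇒γ≥3 : Vertex → (∀ a b → ∃[ v ] Undominated a b v) → ∀ j → ∃[ S ] (Dominating G S × ∣ S ∣ ≡ j) → 3 ≤ j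
  ∃-undominated⇒γ≥3 d undominated j (S , dom , refl) with 3 ≤? ∣ S ∣
  ... | yes 3≤ = 3≤
  ... | no 3≰ with covering-pair S d (s≤s⁻¹ (≰⇒> 3≰))
  ...   | a , b , cover with undominated a b
  ...     | v , v≢a , v≢b , a≁v , b≁v with dom v
  ...       | inj₁ v∈ = contradiction (cover v∈) [ v≢a , v≢b ]′
  ...       | inj₂ (u , u∈ , u~v) with cover u∈
  ...         | inj₁ refl = contradiction u~v a≁v
  ...         | inj₂ refl = contradiction u~v b≁v

  γ≥3⇒∃-undominated : (∀ j → ∃[ S ] (Dominating G S × ∣ S ∣ ≡ j) → 3 ≤ j) → ∀ a b → ∃[ v ] Undominated a b v
  γ≥3⇒∃-undominated γ≥3 a b with any? (λ v → ¬? (v ≟ a) ×-dec (¬? (v ≟ b) ×-dec (¬? (a ~? v) ×-dec ¬? (b ~? v))))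
  ... | yes hit = hit
  ... | no miss = contradiction (∣⁅x⁆∪⁅y⁆∣≤2 a b) (<⇒≱ (γ≥3 _ (⁅ a ⁆ ∪ ⁅ b ⁆ , dominates , refl)))
    where
    dominates : Dominating G (⁅ a ⁆ ∪ ⁅ b ⁆)
    dominates v with v ≟ a | v ≟ b | a ~? v | b ~? v
    ... | yes refl | _        | _       | _       = inj₁ (x∈p∪q⁺ (inj₁ (x∈⁅x⁆ v)))
    ... | no _     | yes refl | _       | _       = inj₁ (x∈p∪q⁺ (inj₂ (x∈⁅x⁆ v)))
    ... | no _     | no _     | yes a~v | _       = inj₂ (a , x∈p∪q⁺ (inj₁ (x∈⁅x⁆ a)) , a~v)
    ... | no _     | no _     | no _    | yes b~v = inj₂ (b , x∈p∪q⁺ (inj₂ (x∈⁅x⁆ b)) , b~v)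
    ... | no v≢a   | no v≢b   | no a≁v  | no b≁v  = contradiction (v , v≢a , v≢b , a≁v , b≁v) miss

  module _ {k} (C : Coloring G k) where
    open Coloring C

    class? : ∀ i → Decidable (Class i)
    class? i v = color v ≟ i

    same-class⇒≁ : ∀ {i u v} → Class i u → Class i v → ¬ u ~ v
    same-class⇒≁ u∈ v∈ u~v = proper u~v (trans u∈ (sym v∈))

    distinct-classes⇒≢ : ∀ {i j u v} → i ≢ j → Class i u → Class j v → u ≢ v
    distinct-classes⇒≢ i≢j refl refl refl = i≢j refl

    incomplete⇒∃-non-neighbor : ∀ {i v} → ¬ CompleteTo G v (Class i) → ∃[ w ] (Class i w × ¬ v ~ w)
    incomplete⇒∃-non-neighbor {i} {v} ¬comp with any? (λ w → class? i w ×-dec ¬? (v ~? w))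
    ... | yes hit = hit
    ... | no miss = contradiction (λ w w∈ → decidable-stable (v ~? w) λ v≁w → miss (w , w∈ , v≁w)) ¬comp

    unique⇒≤classSize : ∀ {m i} (xs : Vec Vertex m) → Unique xs → All (Class i) xs → m ≤ classSize i
    unique⇒≤classSize {i = i} xs uniq xs∈ =
      ≤-trans (unique⇒≤∣p∣ xs uniq (All.map (∈-subset⁺ (class? i)) xs∈)) (≤-reflexive (∣subset∣ (class? i)))

    classSize≡1⇒unique : ∀ {i u v} → classSize i ≡ 1 → Class i u → Class i v → u ≡ v
    classSize≡1⇒unique {u = u} {v} size u∈ v∈ = decidable-stable (u ≟ v) λ u≢v →
      <⇒≱ (unique⇒≤classSize (u ∷ v ∷ []) ((u≢v ∷ []) ∷ [] ∷ []) (u∈ ∷ v∈ ∷ [])) (≤-reflexive size)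

    unique⇒classSize≡1 : ∀ {i v} → Class i v → (∀ u → Class i u → u ≡ v) → classSize i ≡ 1
    unique⇒classSize≡1 {i} {v} v∈ only = ≤-antisym
      (≤-trans (≤-reflexive (sym (∣subset∣ (class? i)))) (≤-trans (p⊆q⇒∣p∣≤∣q∣ singleton) (≤-reflexive (∣⁅x⁆∣≡1 v))))
      (unique⇒≤classSize (v ∷ []) ([] ∷ []) (v∈ ∷ []))
      where
      singleton : subset (class? i) ⊆ ⁅ v ⁆
      singleton {u} u∈ rewrite only u (∈-subset⁻ (class? i) u∈) = x∈⁅x⁆ v

    ∃-third-in-class : ∀ {i} → 3 ≤ classSize i → ∀ a b → ∃[ v ] (Class i v × v ≢ a × v ≢ b)
    ∃-third-in-class {i} 3≤ a b with ∃-outside-pair (≤-trans 3≤ (≤-reflexive (sym (∣subset∣ (class? i))))) a b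
    ... | v , v∈ , v≢a , v≢b = v , ∈-subset⁻ (class? i) v∈ , v≢a , v≢b

-- From the class 𝒟(3) to D(3)

module In𝒟₃⇒IsD (G : Graph) (D : In𝒟₃ G) where
  open Graph G
  open In𝒟₃ D

  ≁-class : ∀ {i u v} → Class i u → Class i v → ¬ u ~ v
  ≁-class = same-class⇒≁ G parts

  ≢-class : ∀ {i j u v} → i ≢ j → Class i u → Class j v → u ≢ v
  ≢-class = distinct-classes⇒≢ G parts

  V₃⇒≡x₃ : ∀ {v} → V₃ v → v ≡ x₃
  V₃⇒≡x₃ v∈ = classSize≡1⇒unique G parts ∣V₃∣≡1 v∈ (x∈V 2F)

  xᵢ~yᵢ : ∀ i → x i ~ y i
  xᵢ~yᵢ i = Equivalence.from (x~y i i) refl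

  xᵢ≁yⱼ : ∀ {i j} → i ≢ j → ¬ x i ~ y j
  xᵢ≁yⱼ i≢j = i≢j ∘ Equivalence.to (x~y _ _)

  -- Condition (a) settles `y₂`, (d) settles the other vertices, and `x₁` is adjacent to `x₃`. With
  -- its mirror image `V₂-complete-V₁` it provides the edges of K₃,₃.
  V₁-complete-V₂ : ∀ {v} → V₁ v → ¬ x₃ ~ v → CompleteTo G v V₂
  V₁-complete-V₂ {v} v∈ x₃≁v with v ≟ y₂ | v ≟ x₁
  ... | yes refl | _        = a₂
  ... | no _     | yes refl = contradiction (~-sym b₁) x₃≁v
  ... | no v≢y₂  | no v≢x₁ with d₁ v v∈ v≢x₁ v≢y₂
  ...   | inj₁ (comp , _) = comp
  ...   | inj₂ (_ , comp) = contradiction (~-sym (comp x₃ (x∈V 2F))) x₃≁v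

  swap-undominated : ∀ {a b} → ∃[ v ] Undominated G a b v → ∃[ v ] Undominated G b a v
  swap-undominated (v , v≢a , v≢b , a≁v , b≁v) = v , v≢b , v≢a , b≁v , a≁v

  -- For non-adjacent `a` and `b` this is condition (e). For adjacent ones either `x₃` is
  -- undominated, or one of the two is adjacent to `x₃` and then misses a vertex of the opposite
  -- class, by (d) or because `x₁` and `y₃` are not adjacent. The other of the two lies in the class
  -- of that vertex, so it does not dominate it either.
  undominated-V₁-V₂ : ∀ {a b} → V₁ a → V₂ b → ∃[ v ] Undominated G a b v
  undominated-V₁-V₂ {a} {b} a∈ b∈ with a ~? b
  ... | no a≁b with e a b a∈ b∈ a≁b
  ...   | inj₁ (w , w∈ , w≢b , a≁w) = w , ≢-class (λ ()) w∈ a∈ , w≢b , a≁w , ≁-class b∈ w∈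
  ...   | inj₂ (v , v∈ , v≢a , b≁v) = v , v≢a , ≢-class (λ ()) v∈ b∈ , ≁-class a∈ v∈ , b≁v
  undominated-V₁-V₂ {a} {b} a∈ b∈ | yes a~b with x₃ ~? a | x₃ ~? b
  ... | no x₃≁a | no x₃≁b =
    x₃ , ≢-class (λ ()) (x∈V 2F) a∈ , ≢-class (λ ()) (x∈V 2F) b∈ , x₃≁a ∘ ~-sym , x₃≁b ∘ ~-sym
  ... | yes x₃~a | _ with a ≟ x₁
  ...   | yes refl =
    y₃ , ≢-class (λ ()) y₃∈V₂ a∈ , (λ { refl → xᵢ≁yⱼ (λ ()) a~b }) , xᵢ≁yⱼ (λ ()) , ≁-class b∈ y₃∈V₂
  ...   | no a≢x₁ with d₁ a a∈ a≢x₁ (λ { refl → xᵢ≁yⱼ (λ ()) x₃~a })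
  ...     | inj₂ (¬comp , _) with incomplete⇒∃-non-neighbor G parts ¬comp
  ...       | w , w∈ , a≁w = w , ≢-class (λ ()) w∈ a∈ , (λ { refl → a≁w a~b }) , a≁w , ≁-class b∈ w∈
  undominated-V₁-V₂ {a} {b} a∈ b∈ | yes a~b | yes x₃~a | _ | no _ | inj₁ (_ , ¬comp) =
    contradiction (λ u u∈ → subst (a ~_) (sym (V₃⇒≡x₃ u∈)) (~-sym x₃~a)) ¬comp
  undominated-V₁-V₂ {a} {b} a∈ b∈ | yes a~b | no _ | yes x₃~b with b ≟ y₃
  ...   | yes refl =
    x₁ , (λ { refl → xᵢ≁yⱼ (λ ()) a~b }) , ≢-class (λ ()) (x∈V 0F) b∈ , ≁-class a∈ (x∈V 0F) , xᵢ≁yⱼ (λ ()) ∘ ~-sym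
  ...   | no b≢y₃ with d₂ b b∈ b≢y₃ (λ { refl → xᵢ≁yⱼ (λ ()) x₃~b })
  ...     | inj₁ (_ , ¬comp) = contradiction (λ u u∈ → subst (b ~_) (sym (V₃⇒≡x₃ u∈)) (~-sym x₃~b)) ¬comp
  ...     | inj₂ (¬comp , _) with incomplete⇒∃-non-neighbor G parts ¬comp
  ...       | v , v∈ , b≁v = v , (λ { refl → b≁v (~-sym a~b) }) , ≢-class (λ ()) v∈ b∈ , ≁-class a∈ v∈ , b≁v

  undominated-class : ∀ {i a b} → 3 ≤ classSize i → Class i a → Class i b → ∃[ v ] Undominated G a b v
  undominated-class {a = a} {b} 3≤ a∈ b∈ with ∃-third-in-class G parts 3≤ a b
  ... | v , v∈ , v≢a , v≢b = v , v≢a , v≢b , ≁-class a∈ v∈ , ≁-class b∈ v∈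

  -- Of two non-neighbors of `x₃` in the class of `a`, one differs from `a`.
  undominated-x₃ : ∀ {i a b} → i ≢ 2F → (∃₂ λ u v → u ≢ v × Class i u × Class i v × ¬ x₃ ~ u × ¬ x₃ ~ v) →
    Class i a → V₃ b → ∃[ v ] Undominated G a b v
  undominated-x₃ {a = a} i≢2 (u , v , u≢v , u∈ , v∈ , x₃≁u , x₃≁v) a∈ b∈ with V₃⇒≡x₃ b∈ | u ≟ a
  ... | refl | no u≢a   = u , u≢a , ≢-class i≢2 u∈ b∈ , ≁-class a∈ u∈ , x₃≁u
  ... | refl | yes refl = v , u≢v ∘ sym , ≢-class i≢2 v∈ b∈ , ≁-class a∈ v∈ , x₃≁v

  undominated : ∀ a b → ∃[ v ] Undominated G a b v
  undominated a b with color a in a∈ | color b in b∈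
  ... | 0F | 0F = undominated-class ∣V₁∣≥3 a∈ b∈
  ... | 0F | 1F = undominated-V₁-V₂ a∈ b∈
  ... | 0F | 2F = undominated-x₃ (λ ()) d₃ a∈ b∈
  ... | 1F | 0F = swap-undominated (undominated-V₁-V₂ b∈ a∈)
  ... | 1F | 1F = undominated-class ∣V₂∣≥3 a∈ b∈
  ... | 1F | 2F = undominated-x₃ (λ ()) d₄ a∈ b∈
  ... | 2F | 0F = swap-undominated (undominated-x₃ (λ ()) d₃ b∈ a∈)
  ... | 2F | 1F = swap-undominated (undominated-x₃ (λ ()) d₄ b∈ a∈)
  ... | 2F | 2F with V₃⇒≡x₃ a∈ | V₃⇒≡x₃ b∈ | d₃
  ...   | refl | refl | u , _ , _ , u∈ , _ , x₃≁u , _ =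
    u , ≢-class (λ ()) u∈ a∈ , ≢-class (λ ()) u∈ b∈ , x₃≁u , x₃≁u

  triple : Subset n
  triple = ⁅ x₃ ⁆ ∪ ⁅ y₁ ⁆ ∪ ⁅ y₂ ⁆

  x₃∈triple : x₃ ∈ triple
  x₃∈triple = x∈p∪q⁺ (inj₁ (x∈⁅x⁆ x₃))

  y₁∈triple : y₁ ∈ triple
  y₁∈triple = x∈p∪q⁺ (inj₂ (x∈p∪q⁺ (inj₁ (x∈⁅x⁆ y₁))))

  y₂∈triple : y₂ ∈ triple
  y₂∈triple = x∈p∪q⁺ (inj₂ (x∈p∪q⁺ (inj₂ (x∈⁅x⁆ y₂))))

  ∣triple∣≡3 : ∣ triple ∣ ≡ 3
  ∣triple∣≡3 = ≤-antisym
    (≤-trans (∣⁅x⁆∪p∣≤1+∣p∣ x₃ (⁅ y₁ ⁆ ∪ ⁅ y₂ ⁆)) (s≤s (∣⁅x⁆∪⁅y⁆∣≤2 y₁ y₂)))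
    (unique⇒≤∣p∣ (x₃ ∷ y₁ ∷ y₂ ∷ [])
      ( (≢-class (λ ()) (x∈V 2F) y₁∈V₂ ∷ ≢-class (λ ()) (x∈V 2F) y₂∈V₁ ∷ [])
      ∷ (≢-class (λ ()) y₁∈V₂ y₂∈V₁ ∷ []) ∷ [] ∷ [])
      (x₃∈triple ∷ y₁∈triple ∷ y₂∈triple ∷ []))

  triple-dominates : Dominating G triple
  triple-dominates v with color v in v∈
  ... | 0F = inj₂ (y₁ , y₁∈triple , a₁ v v∈)
  ... | 1F = inj₂ (y₂ , y₂∈triple , a₂ v v∈)
  ... | 2F = inj₁ (subst (_∈ triple) (sym (V₃⇒≡x₃ v∈)) x₃∈triple)

  colors≥3 : ∀ j → Coloring G j → 3 ≤ j
  colors≥3 0 C with () ← Coloring.color C x₁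
  colors≥3 1 C = contradiction (sub _ _) (Coloring.proper C b₁)
    where
    sub : (i j : Fin 1) → i ≡ j
    sub 0F 0F = refl
  -- With two colors the path `x₁ x₃ y₃ y₂ y₁` alternates, so its ends share a color although they
  -- are adjacent.
  colors≥3 2 C = contradiction
    (trans (alternate (C-proper b₁) (C-proper (xᵢ~yᵢ 2F)))
           (alternate (C-proper (~-sym (a₂ y₃ y₃∈V₂))) (C-proper (~-sym (a₁ y₂ y₂∈V₁)))))
    (C-proper (xᵢ~yᵢ 0F))
    where
    open Coloring C using () renaming (proper to C-proper)
    alternate : ∀ {i j k : Fin 2} → i ≢ j → j ≢ k → i ≡ k
    alternate {0F} {_}  {0F} _ _ = refl
    alternate {1F} {_}  {1F} _ _ = refl
    alternate {0F} {0F} {1F} p _ = contradiction refl p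
    alternate {0F} {1F} {1F} _ q = contradiction refl q
    alternate {1F} {0F} {0F} _ q = contradiction refl q
    alternate {1F} {1F} {0F} p _ = contradiction refl p
  colors≥3 (suc (suc (suc j))) C = s≤s (s≤s (s≤s z≤n))

  parts-dominator : IsDominator G parts
  parts-dominator v with color v in v∈
  ... | 2F = inj₁ (λ u u∈ → trans (V₃⇒≡x₃ u∈) (sym (V₃⇒≡x₃ v∈)))
  ... | 0F with v ≟ x₁ | v ≟ y₂
  ...   | yes refl | _        = inj₂ (2F , λ u u∈ → subst (x₁ ~_) (sym (V₃⇒≡x₃ u∈)) b₁)
  ...   | no _     | yes refl = inj₂ (1F , a₂)
  ...   | no v≢x₁  | no v≢y₂ with d₁ v v∈ v≢x₁ v≢y₂
  ...     | inj₁ (comp , _) = inj₂ (1F , comp)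
  ...     | inj₂ (_ , comp) = inj₂ (2F , comp)
  parts-dominator v | 1F with v ≟ y₃ | v ≟ y₁
  ...   | yes refl | _        = inj₂ (2F , λ u u∈ → subst (y₃ ~_) (sym (V₃⇒≡x₃ u∈)) (~-sym (xᵢ~yᵢ 2F)))
  ...   | no _     | yes refl = inj₂ (0F , a₁)
  ...   | no v≢y₃  | no v≢y₁ with d₂ v v∈ v≢y₃ v≢y₁
  ...     | inj₁ (comp , _) = inj₂ (0F , comp)
  ...     | inj₂ (_ , comp) = inj₂ (2F , comp)

  isD : IsD G 3
  isD = ((triple , triple-dominates , ∣triple∣≡3) , ∃-undominated⇒γ≥3 G x₃ undominated)
      , (parts , colors≥3)
      , ((parts , parts-dominator) , λ j (C , _) → colors≥3 j C)

  V₂-complete-V₁ : ∀ {w} → V₂ w → ¬ x₃ ~ w → CompleteTo G w V₁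
  V₂-complete-V₁ {w} w∈ x₃≁w with w ≟ y₁ | w ≟ y₃
  ... | yes refl | _        = a₁
  ... | no _     | yes refl = contradiction (xᵢ~yᵢ 2F) x₃≁w
  ... | no w≢y₁  | no w≢y₃ with d₂ w w∈ w≢y₃ w≢y₁
  ...   | inj₁ (comp , _) = comp
  ...   | inj₂ (_ , comp) = contradiction (~-sym (comp x₃ (x∈V 2F))) x₃≁w

  -- Two non-neighbors of x₃ on each side, together with x₁ and y₃, span K₃,₃
  -- minus the edge x₁y₃, which the path x₁ x₃ y₃ replaces.
  nonplanar : ¬ Planar G
  nonplanar with d₃ | d₄
  ... | u , u′ , u≢u′ , u∈ , u′∈ , x₃≁u , x₃≁u′ | w , w′ , w≢w′ , w∈ , w′∈ , x₃≁w , x₃≁w′ =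
    subdivided-K₃,₃-nonplanar G (Vec.lookup vertices) (λ {i} {j} → lookup-injective distinct i j)
      b₁ (xᵢ~yᵢ 2F)
      (~-sym (V₁-complete-V₂ u∈ x₃≁u y₃ y₃∈V₂)) (V₁-complete-V₂ u∈ x₃≁u w w∈)
      (~-sym (V₁-complete-V₂ u′∈ x₃≁u′ w w∈)) (V₁-complete-V₂ u′∈ x₃≁u′ w′ w′∈)
      (V₂-complete-V₁ w′∈ x₃≁w′ x₁ (x∈V 0F)) (~-sym (V₂-complete-V₁ w∈ x₃≁w x₁ (x∈V 0F)))
      (~-sym (V₁-complete-V₂ u′∈ x₃≁u′ y₃ y₃∈V₂)) (V₁-complete-V₂ u∈ x₃≁u w′ w′∈)
    where
    vertices : Vec Vertex 7
    -- The order around the heptagon. The sides of K₃,₃ are `x₁`, `u`, `u′` and `y₃`, `w`, `w′`.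
    vertices = x₁ ∷ x₃ ∷ y₃ ∷ u ∷ w ∷ u′ ∷ w′ ∷ []
    ≢₁₂ : ∀ {v w} → V₁ v → V₂ w → v ≢ w
    ≢₁₂ = ≢-class (λ ())
    ≢₃ : ∀ {i v} → 2F ≢ i → Class i v → x₃ ≢ v
    ≢₃ 2≢i = ≢-class 2≢i (x∈V 2F)
    nbr≢ : ∀ {v w} → x₃ ~ v → ¬ x₃ ~ w → v ≢ w
    nbr≢ x₃~v x₃≁w refl = x₃≁w x₃~v
    distinct : Unique vertices
    distinct =
        (≢₃ (λ ()) (x∈V 0F) ∘ sym ∷ ≢₁₂ (x∈V 0F) y₃∈V₂ ∷ nbr≢ (~-sym b₁) x₃≁u ∷ ≢₁₂ (x∈V 0F) w∈
        ∷ nbr≢ (~-sym b₁) x₃≁u′ ∷ ≢₁₂ (x∈V 0F) w′∈ ∷ [])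
      ∷ (≢₃ (λ ()) y₃∈V₂ ∷ ≢₃ (λ ()) u∈ ∷ ≢₃ (λ ()) w∈ ∷ ≢₃ (λ ()) u′∈ ∷ ≢₃ (λ ()) w′∈ ∷ [])
      ∷ (≢₁₂ u∈ y₃∈V₂ ∘ sym ∷ nbr≢ (xᵢ~yᵢ 2F) x₃≁w ∷ ≢₁₂ u′∈ y₃∈V₂ ∘ sym ∷ nbr≢ (xᵢ~yᵢ 2F) x₃≁w′ ∷ [])
      ∷ (≢₁₂ u∈ w∈ ∷ u≢u′ ∷ ≢₁₂ u∈ w′∈ ∷ [])
      ∷ (≢₁₂ u′∈ w∈ ∘ sym ∷ w≢w′ ∷ [])
      ∷ (≢₁₂ u′∈ w′∈ ∷ [])
      ∷ [] ∷ []

-- From D(3) to the class 𝒟(3)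

-- The singleton class of a dominator coloring may carry any color, whereas `In𝒟₃` expects it at
-- `2F`; a transposition of colors will move it there.
recolor : ∀ {G k} → Permutation′ k → Coloring G k → Coloring G k
recolor π C = record
  { color  = λ v → π ⟨$⟩ʳ color v
  ; onto   = λ i → proj₁ (onto (π ⟨$⟩ˡ i)) , trans (cong (π ⟨$⟩ʳ_) (proj₂ (onto (π ⟨$⟩ˡ i)))) (inverseʳ π)
  ; proper = λ u~v e → proper u~v (trans (sym (inverseˡ π)) (trans (cong (π ⟨$⟩ˡ_) e) (inverseˡ π)))
  }
  where open Coloring C

module _ {G k} (π : Permutation′ k) (C : Coloring G k) where
  open Coloring C

  recolor-class⁻ : ∀ {i v} → π ⟨$⟩ʳ color v ≡ π ⟨$⟩ʳ i → color v ≡ i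
  recolor-class⁻ e = trans (sym (inverseˡ π)) (trans (cong (π ⟨$⟩ˡ_) e) (inverseˡ π))

  recolor-dominator : IsDominator G C → IsDominator G (recolor π C)
  recolor-dominator dom v with dom v
  ... | inj₁ alone      = inj₁ (λ u e → alone u (recolor-class⁻ e))
  ... | inj₂ (i , comp) = inj₂ (π ⟨$⟩ʳ i , λ u e → comp u (recolor-class⁻ e))

module FromIsD (G : Graph) (undominated : ∀ a b → ∃[ v ] Undominated G a b v) (χ≥3 : ∀ j → Coloring G j → 3 ≤ j) where
  open Graph G

  IsSingleton : Coloring G 3 → Vertex → Set
  IsSingleton C z = ∀ u → color u ≡ color z → u ≡ z
    where open Coloring C

  module _ (C : Coloring G 3) (all-complete : ∀ v → ∃[ i ] CompleteTo G v (Coloring.Class C i)) where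
    open Coloring C

    -- Two such vertices would dominate the third class as well, as each of its
    -- vertices is complete to one of the other two.
    not-mutually-complete : ∀ {i j u v} → i ≢ j → Class i u → Class j v →
      CompleteTo G u (Class j) → ¬ CompleteTo G v (Class i)
    not-mutually-complete {i} {j} {u} {v} i≢j u∈ v∈ u-comp v-comp with undominated u v
    ... | w , _ , _ , u≁w , v≁w with all-complete w
    ...   | l , w-comp with third i j (color w) l i≢j
                        (λ { refl → v≁w (v-comp w refl) })
                        (λ { refl → u≁w (u-comp w refl) })
                        (λ { refl → ~-irrefl refl (w-comp w refl) })
      where
      third : ∀ (i j k l : Fin 3) → i ≢ j → k ≢ i → k ≢ j → l ≢ k → l ≡ i ⊎ l ≡ j
      third = from-yes (all? λ (i : Fin 3) → all? λ (j : Fin 3) → all? λ (k : Fin 3) → all? λ (l : Fin 3) →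
        ¬? (i ≟ j) →-dec ¬? (k ≟ i) →-dec ¬? (k ≟ j) →-dec ¬? (l ≟ k) →-dec (l ≟ i ⊎-dec l ≟ j))
    ...     | inj₁ refl = u≁w (~-sym (w-comp u u∈))
    ...     | inj₂ refl = v≁w (~-sym (w-comp v v∈))

    -- If some vertex of class i is complete to class j, then every vertex of
    -- class j must be complete to the third class k, hence every vertex of
    -- class k to class j: a mutually complete pair after all.
    no-complete-pair : ∀ {i j k u} → i ≢ j → j ≢ k → (∀ l → l ≡ i ⊎ l ≡ j ⊎ l ≡ k) →
      Class i u → ¬ CompleteTo G u (Class j)
    no-complete-pair {i} {j} {k} i≢j j≢k cover u∈ u-comp with onto j | onto k
    ... | v , v∈ | w , w∈ = not-mutually-complete j≢k v∈ w∈ (j-complete-k v∈) (λ t t∈ → ~-sym (j-complete-k t∈ w w∈))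
      where
      j-complete-k : ∀ {v} → Class j v → CompleteTo G v (Class k)
      j-complete-k {v} v∈ with all-complete v
      ... | l , v-comp with cover l
      ...   | inj₁ refl        = contradiction v-comp (not-mutually-complete i≢j u∈ v∈ u-comp)
      ...   | inj₂ (inj₁ refl) = contradiction (v-comp v v∈) (~-irrefl refl)
      ...   | inj₂ (inj₂ refl) = v-comp

    not-all-complete : ⊥
    not-all-complete with onto 0F
    ... | u , u∈ with all-complete u
    ...   | 0F , u-comp = ~-irrefl refl (u-comp u u∈)
    ...   | 1F , u-comp = no-complete-pair {k = 2F} (λ ()) (λ ())
      (λ { 0F → inj₁ refl ; 1F → inj₂ (inj₁ refl) ; 2F → inj₂ (inj₂ refl) }) u∈ u-comp
    ...   | 2F , u-comp = no-complete-pair {k = 1F} (λ ()) (λ ())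
      (λ { 0F → inj₁ refl ; 1F → inj₂ (inj₂ refl) ; 2F → inj₂ (inj₁ refl) }) u∈ u-comp

  ∃-singleton : (C : Coloring G 3) → IsDominator G C → ∃[ z ] IsSingleton C z
  ∃-singleton C dom with any? (λ z → all? (λ u → Coloring.color C u ≟ Coloring.color C z →-dec u ≟ z))
  ... | yes hit = hit
  ... | no miss = ⊥-elim (not-all-complete C (λ v → [ (λ alone → contradiction (v , alone) miss) , id ]′ (dom v)))

  module _ (C : Coloring G 3) (dom : IsDominator G C) {z : Vertex} (z∈ : Coloring.color C z ≡ 2F)
    (z-single : IsSingleton C z) where
    open Coloring C

    -- The two classes other than that of `z`, in either order, so that each fact about V₁ and V₂ is
    -- proved once for both.
    record Opposite (p q : Fin 3) : Set where
      field
        p≢q   : p ≢ q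
        cover : ∀ i → i ≡ p ⊎ i ≡ q ⊎ i ≡ 2F

    open Opposite

    opposite-sym : ∀ {p q} → Opposite p q → Opposite q p
    opposite-sym O = record { p≢q = p≢q O ∘ sym ; cover = λ i → reorder (cover O i) }
      where
      reorder : ∀ {A B C : Set} → A ⊎ B ⊎ C → B ⊎ A ⊎ C
      reorder (inj₁ a)        = inj₂ (inj₁ a)
      reorder (inj₂ (inj₁ b)) = inj₁ b
      reorder (inj₂ (inj₂ c)) = inj₂ (inj₂ c)

    0-1 : Opposite 0F 1F
    0-1 = record { p≢q = λ () ; cover = λ { 0F → inj₁ refl ; 1F → inj₂ (inj₁ refl) ; 2F → inj₂ (inj₂ refl) } }

    1-0 : Opposite 1F 0F
    1-0 = opposite-sym 0-1

    class-2⇒≡z : ∀ {v} → Class 2F v → v ≡ z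
    class-2⇒≡z v∈ = z-single _ (trans v∈ (sym z∈))

    ≁own-class : ∀ {i u v} → Class i u → Class i v → ¬ u ~ v
    ≁own-class = same-class⇒≁ G C

    module _ {p q : Fin 3} (O : Opposite p q) where

      -- The case that needs an argument is `v` alone in its class. A vertex `w` undominated by `v`
      -- and `z` lies in class `q` and cannot be complete to any class. So `w` is alone too, the
      -- graph has only the vertices `v`, `w`, `z`, and `w` is isolated, against connectedness.
      complete-or-~z : ∀ {v} → Class p v → CompleteTo G v (Class q) ⊎ v ~ z
      complete-or-~z {v} v∈ with dom v
      ... | inj₂ (i , comp) with cover O i
      ...   | inj₁ refl        = contradiction (comp v v∈) (~-irrefl refl)
      ...   | inj₂ (inj₁ refl) = inj₁ comp
      ...   | inj₂ (inj₂ refl) = inj₂ (comp z z∈)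
      complete-or-~z {v} v∈ | inj₁ alone with undominated v z
      ... | w , w≢v , w≢z , v≁w , z≁w with cover O (color w)
      ...   | inj₁ w∈        = contradiction (alone w (trans w∈ (sym v∈))) w≢v
      ...   | inj₂ (inj₂ w∈) = contradiction (class-2⇒≡z w∈) w≢z
      ...   | inj₂ (inj₁ w∈) with dom w
      ...     | inj₂ (i , comp) with cover O i
      ...       | inj₁ refl        = contradiction (~-sym (comp v v∈)) v≁w
      ...       | inj₂ (inj₁ refl) = contradiction (comp w w∈) (~-irrefl refl)
      ...       | inj₂ (inj₂ refl) = contradiction (~-sym (comp z z∈)) z≁w
      complete-or-~z {v} v∈ | inj₁ alone | w , w≢v , w≢z , v≁w , z≁w | inj₂ (inj₁ w∈) | inj₁ w-alone with connected w v
      ... | ε = contradiction refl w≢v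
      ... | _◅_ {j = t} w~t _ with cover O (color t)
      ...   | inj₁ t∈        = contradiction (~-sym (subst (w ~_) (alone t (trans t∈ (sym v∈))) w~t)) v≁w
      ...   | inj₂ (inj₁ t∈) = contradiction w~t (≁own-class w∈ t∈)
      ...   | inj₂ (inj₂ t∈) = contradiction (~-sym (subst (w ~_) (class-2⇒≡z t∈) w~t)) z≁w

      ≁z⇒complete : ∀ {v} → Class p v → ¬ z ~ v → CompleteTo G v (Class q)
      ≁z⇒complete v∈ z≁v with complete-or-~z v∈
      ... | inj₁ comp = comp
      ... | inj₂ v~z  = contradiction (~-sym v~z) z≁v

      -- A vertex undominated by `z` and `w` cannot lie in class `p`: being non-adjacent to `z`, it
      -- would be complete to class `q` and hence adjacent to `w`.
      other-non-neighbor : ∀ {w} → Class q w → ∃[ w′ ] (w ≢ w′ × Class q w′ × ¬ z ~ w′)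
      other-non-neighbor {w} w∈ with undominated z w
      ... | t , t≢z , t≢w , z≁t , w≁t with cover O (color t)
      ...   | inj₁ t∈        = contradiction (~-sym (≁z⇒complete t∈ z≁t w w∈)) w≁t
      ...   | inj₂ (inj₁ t∈) = t , t≢w ∘ sym , t∈ , z≁t
      ...   | inj₂ (inj₂ t∈) = contradiction (class-2⇒≡z t∈) t≢z

      two-non-neighbors : ∃₂ λ u v → u ≢ v × Class q u × Class q v × ¬ z ~ u × ¬ z ~ v
      two-non-neighbors with onto q
      ... | w , w∈ with other-non-neighbor w∈
      ...   | u , _ , u∈ , z≁u with other-non-neighbor u∈
      ...     | v , u≢v , v∈ , z≁v = u , v , u≢v , u∈ , v∈ , z≁u , z≁v

      -- Otherwise z could join class p.
      has-neighbor : ∃[ v ] (Class p v × z ~ v)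
      has-neighbor with any? (λ v → class? G C p v ×-dec (z ~? v))
      ... | yes hit = hit
      ... | no miss = contradiction (χ≥3 2 merged) (<⇒≱ (s≤s (s≤s (s≤s z≤n))))
        where
        merge : Fin 3 → Fin 2
        merge i = if does (i ≟ q) then 1F else 0F
        merge-≡ : ∀ {i} → i ≡ q → merge i ≡ 1F
        merge-≡ {i} i≡q rewrite dec-true (i ≟ q) i≡q = refl
        merge-≢ : ∀ {i} → i ≢ q → merge i ≡ 0F
        merge-≢ {i} i≢q rewrite dec-false (i ≟ q) i≢q = refl
        merge-proper : ∀ {u v} → u ~ v → merge (color u) ≢ merge (color v)
        merge-proper {u} {v} u~v e with color u ≟ q | color v ≟ q
        ... | yes u∈ | yes v∈ = ≁own-class u∈ v∈ u~v
        ... | yes u∈ | no v∉  with () ← e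
        ... | no u∉  | yes v∈ with () ← e
        ... | no u∉  | no v∉  with cover O (color u) | cover O (color v)
        ...   | inj₂ (inj₁ u∈) | _              = u∉ u∈
        ...   | _              | inj₂ (inj₁ v∈) = v∉ v∈
        ...   | inj₁ u∈        | inj₁ v∈        = ≁own-class u∈ v∈ u~v
        ...   | inj₂ (inj₂ u∈) | inj₂ (inj₂ v∈) = ≁own-class u∈ v∈ u~v
        ...   | inj₁ u∈        | inj₂ (inj₂ v∈) = miss (u , u∈ , ~-sym (subst (u ~_) (class-2⇒≡z v∈) u~v))
        ...   | inj₂ (inj₂ u∈) | inj₁ v∈        = miss (v , v∈ , subst (_~ v) (class-2⇒≡z u∈) u~v)
        merged : Coloring G 2
        merged = record
          { color  = merge ∘ color
          ; onto   = λ
            { 0F → proj₁ (onto p) , merge-≢ (λ e → p≢q O (trans (sym (proj₂ (onto p))) e))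
            ; 1F → proj₁ (onto q) , merge-≡ (proj₂ (onto q))
            }
          ; proper = merge-proper
          }

    module _ {p q : Fin 3} (O : Opposite p q) where

      -- Otherwise `v` would dominate class `q` and `z`, and a non-neighbor `y` of `z` in class `q`,
      -- being complete to class `p`, would dominate the rest.
      not-both : ∀ {v} → Class p v → CompleteTo G v (Class q) → ¬ v ~ z
      not-both {v} v∈ comp v~z with two-non-neighbors O
      ... | y , _ , _ , y∈ , _ , z≁y , _ with undominated v y
      ...   | t , _ , _ , v≁t , y≁t with cover O (color t)
      ...     | inj₁ t∈        = y≁t (≁z⇒complete (opposite-sym O) y∈ z≁y t t∈)
      ...     | inj₂ (inj₁ t∈) = v≁t (comp t t∈)
      ...     | inj₂ (inj₂ t∈) = v≁t (subst (v ~_) (sym (class-2⇒≡z t∈)) v~z)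

      exactly-one : ∀ {v} → Class p v → OneButNotBoth (CompleteTo G v (Class q)) (CompleteTo G v (Class 2F))
      exactly-one {v} v∈ with complete-or-~z O v∈
      ... | inj₁ comp = inj₁ (comp , λ comp₂ → not-both v∈ comp (comp₂ z z∈))
      ... | inj₂ v~z  = inj₂ ((λ comp → not-both v∈ comp v~z) , λ u u∈ → subst (v ~_) (sym (class-2⇒≡z u∈)) v~z)

    -- This provides `x₁` and `y₃`. A vertex `t` undominated by neighbors `a`, `b` of `z` replaces
    -- whichever of them shares its class: `t` misses the other one, so it is not complete to the
    -- opposite class and must be adjacent to `z`.
    non-adjacent-neighbors : ∃₂ λ v w → Class 0F v × Class 1F w × z ~ v × z ~ w × ¬ v ~ w
    non-adjacent-neighbors with has-neighbor 0-1 | has-neighbor 1-0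
    ... | a , a∈ , z~a | b , b∈ , z~b with undominated a b
    ...   | t , _ , _ , a≁t , b≁t with color t in t∈
    ...     | 0F = t , b , t∈ , b∈ ,
      decidable-stable (z ~? t) (λ z≁t → b≁t (~-sym (≁z⇒complete 0-1 t∈ z≁t b b∈))) , z~b , b≁t ∘ ~-sym
    ...     | 1F = a , t , a∈ , t∈ , z~a ,
      decidable-stable (z ~? t) (λ z≁t → a≁t (~-sym (≁z⇒complete 1-0 t∈ z≁t a a∈))) , a≁t
    ...     | 2F = contradiction (~-sym (subst (_~ a) (sym (class-2⇒≡z t∈)) z~a)) a≁t

    in𝒟₃ : In𝒟₃ G
    in𝒟₃ with non-adjacent-neighbors | two-non-neighbors 1-0 | two-non-neighbors 0-1
    ... | x₁ , y₃ , x₁∈ , y₃∈ , z~x₁ , z~y₃ , x₁≁y₃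
        | ds@(y₂ , v , y₂≢v , y₂∈ , v∈ , z≁y₂ , z≁v)
        | ds′@(y₁ , w , y₁≢w , y₁∈ , w∈ , z≁y₁ , z≁w) = record
      { parts = C
      ; ∣V₁∣≥3 = unique⇒≤classSize G C (x₁ ∷ y₂ ∷ v ∷ [])
          ((nbr≢ z~x₁ z≁y₂ ∷ nbr≢ z~x₁ z≁v ∷ []) ∷ (y₂≢v ∷ []) ∷ [] ∷ []) (x₁∈ ∷ y₂∈ ∷ v∈ ∷ [])
      ; ∣V₂∣≥3 = unique⇒≤classSize G C (y₃ ∷ y₁ ∷ w ∷ [])
          ((nbr≢ z~y₃ z≁y₁ ∷ nbr≢ z~y₃ z≁w ∷ []) ∷ (y₁≢w ∷ []) ∷ [] ∷ []) (y₃∈ ∷ y₁∈ ∷ w∈ ∷ [])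
      ; ∣V₃∣≡1 = unique⇒classSize≡1 G C z∈ (λ u u∈ → class-2⇒≡z u∈)
      ; x = x
      ; y = y
      ; x∈V = λ { 0F → x₁∈ ; 1F → y₁∈ ; 2F → z∈ }
      ; x~y = λ
        { 0F 0F → both (~-sym (y₁-complete x₁ x₁∈))
        ; 0F 1F → neither (≁own-class x₁∈ y₂∈) (λ ())
        ; 0F 2F → neither x₁≁y₃ (λ ())
        ; 1F 0F → neither (~-irrefl refl) (λ ())
        ; 1F 1F → both (y₁-complete y₂ y₂∈)
        ; 1F 2F → neither (≁own-class y₁∈ y₃∈) (λ ())
        ; 2F 0F → neither z≁y₁ (λ ())
        ; 2F 1F → neither z≁y₂ (λ ())
        ; 2F 2F → both z~y₃
        }
      ; y₁∈V₂ = y₁∈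
      ; y₂∈V₁ = y₂∈
      ; y₃∈V₂ = y₃∈
      ; a₁ = y₁-complete
      ; a₂ = y₂-complete
      ; b₁ = ~-sym z~x₁
      ; b₂ = y₁ , y₁∈ , nbr≢ z~y₃ z≁y₁ ∘ sym , ~-sym (y₁-complete x₁ x₁∈)
      ; c  = y₂ , y₂∈ , nbr≢ z~x₁ z≁y₂ ∘ sym , ~-sym (y₂-complete y₃ y₃∈)
      ; d₁ = λ v v∈ _ _ → exactly-one 0-1 v∈
      ; d₂ = λ w w∈ _ _ → exactly-one 1-0 w∈
      ; d₃ = ds
      ; d₄ = ds′
      ; e  = condition-e
      }
      where
      x y : Fin 3 → Vertex
      -- The same vertex serves as `x₂` and as `y₁`: it is complete to V₁, so adjacent to `y₂`, but
      -- neither to itself nor to `y₃` in its own class.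
      x = λ { 0F → x₁ ; 1F → y₁ ; 2F → z }
      y = λ { 0F → y₁ ; 1F → y₂ ; 2F → y₃ }
      y₁-complete : CompleteTo G y₁ (Class 0F)
      y₁-complete = ≁z⇒complete 1-0 y₁∈ z≁y₁
      y₂-complete : CompleteTo G y₂ (Class 1F)
      y₂-complete = ≁z⇒complete 0-1 y₂∈ z≁y₂
      nbr≢ : ∀ {u v} → z ~ u → ¬ z ~ v → u ≢ v
      nbr≢ z~u z≁v refl = z≁v z~u
      both : ∀ {A : Set} {i : Fin 3} → A → A ⇔ i ≡ i
      both a = mk⇔ (λ _ → refl) (λ _ → a)
      neither : ∀ {A B : Set} → ¬ A → ¬ B → A ⇔ B
      neither ¬a ¬b = mk⇔ (λ a → contradiction a ¬a) (λ b → contradiction b ¬b)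
      condition-e : ∀ v w → Class 0F v → Class 1F w → ¬ v ~ w →
          (∃[ w′ ] (Class 1F w′ × w′ ≢ w × ¬ v ~ w′))
        ⊎ (∃[ v′ ] (Class 0F v′ × v′ ≢ v × ¬ w ~ v′))
      condition-e v w v∈ w∈ v≁w with undominated v w
      ... | t , t≢v , t≢w , v≁t , w≁t with color t in t∈
      ...   | 0F = inj₂ (t , t∈ , t≢v , w≁t)
      ...   | 1F = inj₁ (t , t∈ , t≢w , v≁t)
      -- If `z` itself is undominated, then `v` is not adjacent to `z`, hence complete to V₂ and
      -- adjacent to `w`.
      ...   | 2F = contradiction
        (≁z⇒complete 0-1 v∈ (λ z~v → v≁t (~-sym (subst (_~ v) (sym (class-2⇒≡z t∈)) z~v))) w w∈)
        v≁w

IsD⇒In𝒟₃ : ∀ (G : Graph) → IsD G 3 → In𝒟₃ G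
IsD⇒In𝒟₃ G ((_ , γ≥3) , (_ , χ≥3) , ((C , dom) , _)) with γ≥3⇒∃-undominated G γ≥3
... | undominated with FromIsD.∃-singleton G undominated χ≥3 C dom
...   | z , z-single =
  FromIsD.in𝒟₃ G undominated χ≥3 (recolor π C) (recolor-dominator π C dom) {z} z∈
    (λ u e → z-single u (recolor-class⁻ π C e))
  where
  open Coloring C
  π : Permutation′ 3
  π = transpose (color z) 2F
  z∈ : π ⟨$⟩ʳ color z ≡ 2F
  z∈ rewrite dec-true (color z ≟ color z) refl = refl

theorem3 : (∀ (G : Graph) → IsD G 3 ⇔ In𝒟₃ G)
    × ¬ (∃[ G ] (Planar G × IsD G 3))
theorem3 = (λ G → mk⇔ (IsD⇒In𝒟₃ G) (In𝒟₃⇒IsD.isD G))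
         , λ (G , planar , isD) → In𝒟₃⇒IsD.nonplanar G (IsD⇒In𝒟₃ G isD) planar
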